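{- Let $n\ge 2$. The Haj\'os number of the symmetric cycle $D(C_{2^n+1})$ of order $2^n+1$ is at most $$\frac{n\left(2^{n+2}+n+5\right)}{2}-7.$$ Moreover, for every integer $m$ with $2^{n-1}+1<2m+1<2^n+1$, the Haj\'os number of the symmetric cycle $D(C_{2m+1})$ of order $2m+1$ is at most $$\frac{n\left(2^{n+2}+n+5\right)}{2}-5.$$
   Context: Digraphs are finite, without loops or multiple arcs. For a graph $G$, $D(G)$ is the symmetric digraph obtained by replacing each edge by a pair of opposite arcs; $D(K_3)$ is the complete symmetric digraph on 3 vertices and $D(C_k)$ the symmetric cycle of order $k$. The dichromatic number of a digraph is the minimum number of colors in a vertex coloring with no monochromatic directed cycle; odd symmetric cycles have dichromatic number 3. The directed Haj\'os operations are: (1) identifying a nonempty independent set $I$ of vertices: delete $I$, add a new vertex $v$, and add all arcs from $v$ to $\bigcup_{u\in I}N^+(u)$ and from $\bigcup_{u\in I}N^-(u)$ to $v$; (2) the directed Haj\'os join $(D_1,u_1,v_1)\triangledown(D_2,v_2,u_2)$ of disjoint digraphs $D_1,D_2$ with $u_1v_1\in A(D_1)$, $v_2u_2\in A(D_2)$: take the disjoint union, delete the arcs $u_1v_1$ and $v_2u_2$, identify $v_1$ and $v_2$ into a single vertex, and add the arc $u_1u_2$. The Haj\'os number of an $r$-dichromatic digraph $H$ is the minimum number of directed Haj\'os operations needed to obtain $H$ (up to isomorphism) from copies of the complete symmetric digraph $D(K_r)$, operations being applied to copies of $D(K_r)$ and to previously obtained digraphs. -}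

module Defs where

open import Data.Bool using (Bool; T)
open import Data.Empty using (⊥)
open import Data.Fin using (Fin; toℕ; _≟_)
open import Data.Fin.Subset using (Subset; _∈_; _∉_; Nonempty)
open import Data.Irrelevant using ([_])
open import Data.List using (List; []; _∷_; length)
open import Data.List.Membership.Propositional using () renaming (_∈_ to _∈ₗ_)
open import Data.Maybe using (Maybe; just; nothing) renaming (map to mapMaybe)
open import Data.Nat using (ℕ; suc; _≤_)
open import Data.Nat.Properties using () renaming (_≟_ to _≟ℕ_)
open import Data.Product using (Σ; ∃; ∃₂; _×_; _,_; proj₁)
open import Data.Refinement using (Refinement-syntax; value; _,_)
open import Data.Sum using (_⊎_; inj₁; inj₂) renaming (swap to swap⊎)
open import Function using (_∘_)
open import Function.Bundles using (_↔_; _⇔_; Inverse)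
open import Function.Definitions using (Injective)
open import Relation.Binary.Definitions using (Decidable)
open import Relation.Binary.PropositionalEquality using (_≡_; _≢_; refl; sym)
open import Relation.Nullary using (¬_; yes; no)
open import Relation.Nullary.Decidable using (⌊_⌋; ¬?; _×-dec_; _⊎-dec_; toWitness; fromWitness)

IsMinimum : (ℕ → Set) → ℕ → Set
IsMinimum P k = P k × (∀ l → P l → k ≤ l)

record Graph : Set where
  field
    order       : ℕ
    edge        : Fin order → Fin order → Bool
    symmetric   : ∀ u v → T (edge u v) → T (edge v u)
    irreflexive : ∀ v → ¬ T (edge v v)

record Digraph : Set where
  field
    order    : ℕ
    arc      : Fin order → Fin order → Bool
    loopless : ∀ v → ¬ T (arc v v)

  Vertex : Set
  Vertex = Fin order

  Arc : Vertex → Vertex → Set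
  Arc u v = T (arc u v)

open Digraph public using (Vertex; Arc)

D : Graph → Digraph
D G = record { order = order ; arc = edge ; loopless = irreflexive }
  where open Graph G

K : ℕ → Graph
K r = record
  { order       = r
  ; edge        = λ u v → ⌊ adjacent? u v ⌋
  ; symmetric   = λ u v e → fromWitness {a? = adjacent? v u} (toWitness {a? = adjacent? u v} e ∘ sym)
  ; irreflexive = λ v e → toWitness {a? = adjacent? v v} e refl
  }
  where
  adjacent? : Decidable (λ (u v : Fin r) → u ≢ v)
  adjacent? u v = ¬? (u ≟ v)

-- j ≡ i + 1 modulo k
CyclicSuc : ∀ {k} → Fin k → Fin k → Set
CyclicSuc {k} i j = toℕ j ≡ suc (toℕ i) ⊎ (suc (toℕ i) ≡ k × toℕ j ≡ 0)

cyclicSuc? : ∀ {k} → Decidable (CyclicSuc {k})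
cyclicSuc? {k} i j = (toℕ j ≟ℕ suc (toℕ i)) ⊎-dec ((suc (toℕ i) ≟ℕ k) ×-dec (toℕ j ≟ℕ 0))

-- The condition u ≢ v excludes a loop when k = 1; for k ≥ 2 it is redundant.
CycleAdjacent : ∀ {k} → Fin k → Fin k → Set
CycleAdjacent u v = u ≢ v × (CyclicSuc u v ⊎ CyclicSuc v u)

-- The cycle of order k, for k ≥ 3.
C : ℕ → Graph
C k = record
  { order       = k
  ; edge        = λ u v → ⌊ adjacent? u v ⌋
  ; symmetric   = λ u v e → let (u≢v , s) = toWitness {a? = adjacent? u v} e in
                    fromWitness {a? = adjacent? v u} (u≢v ∘ sym , swap⊎ s)
  ; irreflexive = λ v e → proj₁ (toWitness {a? = adjacent? v v} e) refl
  }
  where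
  adjacent? : Decidable (CycleAdjacent {k})
  adjacent? u v = ¬? (u ≟ v) ×-dec (cyclicSuc? u v ⊎-dec cyclicSuc? v u)

record DirectedCycle (G : Digraph) : Set where
  field
    len       : ℕ
    nonempty  : 1 ≤ len
    vertex    : Fin len → Vertex G
    injective : Injective _≡_ _≡_ vertex
    arcs      : ∀ i j → CyclicSuc i j → Arc G (vertex i) (vertex j)

Monochromatic : ∀ {G k} → (Vertex G → Fin k) → DirectedCycle G → Set
Monochromatic c Z = ∀ i j → c (vertex i) ≡ c (vertex j)
  where open DirectedCycle Z

Dicolourable : Digraph → ℕ → Set
Dicolourable G k = Σ (Vertex G → Fin k) λ c → ∀ (Z : DirectedCycle G) → ¬ Monochromatic c Z

IsDichromaticNumber : Digraph → ℕ → Set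
IsDichromaticNumber G = IsMinimum (Dicolourable G)

-- Results of the Hajós operations live on their natural vertex sets, not on
-- some Fin n; a Digraph is matched against them by an isomorphism.
record RawDigraph : Set₁ where
  field
    Vertexʳ : Set
    Arcʳ    : Vertexʳ → Vertexʳ → Set

open RawDigraph public

⟦_⟧ : Digraph → RawDigraph
⟦ G ⟧ = record { Vertexʳ = Vertex G ; Arcʳ = Arc G }

infix 4 _≅_
_≅_ : RawDigraph → RawDigraph → Set
G ≅ H = Σ (Vertexʳ G ↔ Vertexʳ H) λ f →
  ∀ u v → Arcʳ G u v ⇔ Arcʳ H (Inverse.to f u) (Inverse.to f v)

module _ (G : Digraph) where
  open Digraph G using (order)

  Independent : Subset order → Set
  Independent I = ∀ u v → u ∈ I → v ∈ I → ¬ Arc G u v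

  -- The new vertex is nothing.
  identify : Subset order → RawDigraph
  identify I = record { Vertexʳ = Maybe [ u ∈ Vertex G ∣ u ∉ I ] ; Arcʳ = arcs }
    where
    arcs : Maybe [ u ∈ Vertex G ∣ u ∉ I ] → Maybe [ u ∈ Vertex G ∣ u ∉ I ] → Set
    arcs (just x) (just y) = Arc G (value x) (value y)
    arcs nothing  (just y) = ∃ λ u → u ∈ I × Arc G u (value y)
    arcs (just x) nothing  = ∃ λ u → u ∈ I × Arc G (value x) u
    arcs nothing  nothing  = ⊥

collapse : ∀ {n} (v : Fin n) → Fin n → Maybe [ x ∈ Fin n ∣ x ≢ v ]
collapse v x with x ≟ v
... | yes _   = nothing
... | no  x≢v = just (x , [ x≢v ])

module _ (G₁ : Digraph) (u₁ v₁ : Vertex G₁) (G₂ : Digraph) (v₂ u₂ : Vertex G₂) where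

  -- The vertex obtained from v₁ and v₂ is nothing.
  JoinVertex : Set
  JoinVertex = Maybe ([ x ∈ Vertex G₁ ∣ x ≢ v₁ ] ⊎ [ x ∈ Vertex G₂ ∣ x ≢ v₂ ])

  ι₁ : Vertex G₁ → JoinVertex
  ι₁ x = mapMaybe inj₁ (collapse v₁ x)

  ι₂ : Vertex G₂ → JoinVertex
  ι₂ x = mapMaybe inj₂ (collapse v₂ x)

  JoinArc : JoinVertex → JoinVertex → Set
  JoinArc p q =
      (∃₂ λ x y → Arc G₁ x y × ¬ (x ≡ u₁ × y ≡ v₁) × p ≡ ι₁ x × q ≡ ι₁ y)
    ⊎ (∃₂ λ x y → Arc G₂ x y × ¬ (x ≡ v₂ × y ≡ u₂) × p ≡ ι₂ x × q ≡ ι₂ y)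
    ⊎ (p ≡ ι₁ u₁ × q ≡ ι₂ u₂)

  -- (G₁ , u₁ , v₁) ▽ (G₂ , v₂ , u₂)
  hajósJoin : RawDigraph
  hajósJoin = record { Vertexʳ = JoinVertex ; Arcʳ = JoinArc }

data HajósOperation (Available : Digraph → Set) (H : Digraph) : Set where
  identification : ∀ G → Available G →
                   (I : Subset (Digraph.order G)) → Nonempty I → Independent G I →
                   ⟦ H ⟧ ≅ identify G I →
                   HajósOperation Available H
  join           : ∀ G₁ G₂ → Available G₁ → Available G₂ →
                   (u₁ v₁ : Vertex G₁) → Arc G₁ u₁ v₁ →
                   (v₂ u₂ : Vertex G₂) → Arc G₂ v₂ u₂ →
                   ⟦ H ⟧ ≅ hajósJoin G₁ u₁ v₁ G₂ v₂ u₂ →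
                   HajósOperation Available H

AvailableFrom : ℕ → List Digraph → Digraph → Set
AvailableFrom r Gs G = G ≡ D (K r) ⊎ G ∈ₗ Gs

-- The digraphs obtained so far, latest first. Each entry costs one operation
-- and can be used any number of times afterwards, as can D (K r).
data HajósConstruction (r : ℕ) : List Digraph → Set where
  []  : HajósConstruction r []
  _∷_ : ∀ {H Gs} → HajósOperation (AvailableFrom r Gs) H →
        HajósConstruction r Gs → HajósConstruction r (H ∷ Gs)

ObtainableIn : ℕ → Digraph → ℕ → Set
ObtainableIn r H k = ∃ λ Gs → HajósConstruction r Gs × length Gs ≡ k ×
  (∃ λ G → AvailableFrom r Gs G × ⟦ H ⟧ ≅ ⟦ G ⟧)

IsHajósNumber : Digraph → ℕ → Set
IsHajósNumber H h = ∃ λ r → IsDichromaticNumber H r × IsMinimum (ObtainableIn r H) h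

{-# OPTIONS --safe #-}
-- A rank that increases along monochromatic arcs certifies a 2-colouring without
-- monochromatic directed cycles, and 2-colourability in this sense pulls back along
-- identifications and passes from a join to one of its two parts. So nothing built
-- from D(K₃) is 2-colourable, whereas every proper subdigraph of an odd symmetric
-- cycle is: a built digraph mapped homomorphically to D(C_N), N odd, becomes D(C_N)
-- once all fibres have been merged, in at most N operations.
--
-- Doubling, from D(C_{d+1}) to D(C_N) with N = 2d + 1: label the vertices of C_N by
-- ℤ/N so that neighbours differ by 2. The labels of D(C_{d+1}) can be chosen so that
-- all its arcs are arcs of C_N except 0 → 1 and 1 → 0. Joining two digraphs along
-- u → v and v → w, where u and w are neighbours, removes both of these arcs. Two
-- shifted copies of {0 → 1, 1 → 0} thus give {0 → 1, 1 → 2}; repeatedly joining with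
-- shifts of the latter gives {0 → 1, 2k+1 → 2k+2}, and for k = d both remaining arcs
-- are 0 → 1. After merging the fibres of 0 and 1 this is a single arc, and a join
-- with a copy shifted by 1 leaves arcs of C_N only. This costs 3d + 5 operations.
-- Shorter odd cycles are obtained by folding.
--
-- The Hajós number exists as a minimum because reaching a digraph in k operations is
-- decidable: up to isomorphism, one operation on given digraphs has finitely many
-- outcomes.
module Submission where

open import Defs
open import Data.Bool using (Bool; T?; false; if_then_else_; not; true)
open import Data.Bool.Properties using (not-involutive; not-¬) renaming (_≟_ to _≟ᵇ_)
open import Data.Empty using (⊥-elim; ⊥-elim-irr)
open import Data.Fin using (Fin; _≟_; fromℕ<; suc; toℕ; zero)
open import Data.Fin.Properties using (+↔⊎; all?; any?; toℕ-fromℕ<; toℕ-injective; toℕ<n)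
open import Data.Fin.Subset using (Nonempty; Subset; _∈_; _∉_)
open import Data.Fin.Subset.Properties using (_∈?_; anySubset?; nonempty?)
open import Data.Irrelevant using ([_])
open import Data.List using (List; []; _∷_; allFin; length)
open import Data.List.Membership.Propositional using (find; lose) renaming (_∈_ to _∈ₗ_)
open import Data.List.Membership.Propositional.Properties using (∈-allFin)
open import Data.List.Properties using (length-tabulate)
open import Data.List.Relation.Binary.Pointwise using (Pointwise; []; _∷_)
open import Data.List.Relation.Unary.All using (All; []; _∷_)
open import Data.List.Relation.Unary.Any using (Any; here; there) renaming (any? to anyₗ?)
open import Data.Maybe using (Maybe; just; nothing) renaming (map to mapMaybe)
open import Data.Nat using (_%_; _*_; _+_; _/_; _<_; _^_; _∸_; _≤?_; _≤_; suc; s≤s; s≤s⁻¹; zero; z≤n; ℕ) renaming (_≟_ to _≟ℕ_)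
open import Data.Nat.DivMod using (%-distribˡ-*; %-distribˡ-+; /-monoˡ-≤; [m+n]%n≡m%n; m%n%n≡m%n; m%n<n; m*n/n≡m; m<n⇒m%n≡m; n%n≡0)
open import Data.Nat.Properties using (*-cancelˡ-<; *-comm; *-monoʳ-≤; *-monoˡ-≤; +-assoc; +-cancelʳ-<; +-comm; +-identityʳ; +-monoʳ-≤; +-monoˡ-≤; +-suc; 0≢1+n; 1+n≢n; <-asym; <-irrefl; <⇒≤; ^-distribˡ-+-*; _<?_; m+n≤o⇒m≤o∸n; m^n>0; module ≤-Reasoning; m≤m+n; m≤n+m; m≤n⇒m<n∨m≡n; m≤n⇒m≤1+n; suc-injective; ≤-antisym; ≤-pred; ≤-refl; ≤-reflexive; ≤-trans; ≮⇒≥)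
open import Data.Nat.Tactic.RingSolver using (solve-∀)
open import Data.Product using (_,_; _×_; proj₁; proj₂; Σ; ∃; ∃₂)
open import Data.Refinement using (Refinement-syntax; _,_; value)
open import Data.Sum using (_⊎_; inj₁; inj₂) renaming (map to map⊎; swap to swap⊎)
open import Data.Sum.Function.Propositional using (_⊎-↔_)
open import Data.Vec using (Vec; []; _∷_; lookup; tabulate)
open import Data.Vec.Properties using ([]=⇒lookup; lookup⇒[]=; lookup∘tabulate)
open import Function using (_∘_; id)
open import Function.Bundles using (Equivalence; Inverse; _↔_; mk↔ₛ′; mk⇔)
open import Function.Construct.Composition using (_↔-∘_)
open import Function.Construct.Symmetry using (↔-sym)
open import Relation.Binary.Definitions using (Decidable; DecidableEquality)
open import Relation.Binary.PropositionalEquality using (_≡_; _≢_; cong; refl; subst; subst₂; sym; trans)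
open import Relation.Nullary using (Dec; contradiction; no; yes; ¬_)
open import Relation.Nullary.Decidable using (_×-dec_; _→-dec_; _⊎-dec_; dec-true; does; from-yes; fromWitness; map′; toWitness; ¬?; ⌊_⌋)
import Relation.Unary as U
import Data.List.Relation.Unary.All as All

-- Isomorphisms

record Iso (G H : RawDigraph) : Set where
  field
    to      : Vertexʳ G → Vertexʳ H
    from    : Vertexʳ H → Vertexʳ G
    to∘from : ∀ y → to (from y) ≡ y
    from∘to : ∀ x → from (to x) ≡ x
    arc→    : ∀ {u v} → Arcʳ G u v → Arcʳ H (to u) (to v)
    arc←    : ∀ {u v} → Arcʳ H u v → Arcʳ G (from u) (from v)

  to-injective : ∀ {x y} → to x ≡ to y → x ≡ y
  to-injective eq = trans (sym (from∘to _)) (trans (cong from eq) (from∘to _))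

Iso⇒≅ : ∀ {G H} → Iso G H → G ≅ H
Iso⇒≅ {G} i = mk↔ₛ′ to from to∘from from∘to ,
  λ u v → mk⇔ arc→ (subst₂ (Arcʳ G) (from∘to u) (from∘to v) ∘ arc←)
  where open Iso i

≅⇒Iso : ∀ {G H} → G ≅ H → Iso G H
≅⇒Iso {G} {H} (f , arcs) = record
  { to      = to
  ; from    = from
  ; to∘from = to∘from
  ; from∘to = λ x → Inverse.inverseʳ f refl
  ; arc→    = λ {u} {v} → Equivalence.to (arcs u v)
  ; arc←    = λ {u} {v} a → Equivalence.from (arcs (from u) (from v))
                (subst₂ (Arcʳ H) (sym (to∘from u)) (sym (to∘from v)) a)
  }
  where
  open Inverse f using (to; from)

  to∘from : ∀ y → to (from y) ≡ y
  to∘from y = Inverse.inverseˡ f refl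

Iso-refl : ∀ {G} → Iso G G
Iso-refl = record
  { to = id ; from = id ; to∘from = λ _ → refl ; from∘to = λ _ → refl ; arc→ = id ; arc← = id }

Iso-sym : ∀ {G H} → Iso G H → Iso H G
Iso-sym i = record
  { to = from ; from = to ; to∘from = from∘to ; from∘to = to∘from ; arc→ = arc← ; arc← = arc→ }
  where open Iso i

Iso-trans : ∀ {G H J} → Iso G H → Iso H J → Iso G J
Iso-trans i j = record
  { to      = J.to ∘ I.to
  ; from    = I.from ∘ J.from
  ; to∘from = λ y → trans (cong J.to (I.to∘from _)) (J.to∘from y)
  ; from∘to = λ x → trans (cong I.from (J.from∘to _)) (I.from∘to x)
  ; arc→    = J.arc→ ∘ I.arc→
  ; arc←    = I.arc← ∘ J.arc←
  }
  where module I = Iso i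
        module J = Iso j

-- Finite raw digraphs

Finite : Set → Set
Finite A = ∃ λ n → A ↔ Fin n

finite-≟ : ∀ {A} → Finite A → DecidableEquality A
finite-≟ (_ , f) x y = map′
  (λ eq → trans (sym (Inverse.inverseʳ f refl)) (trans (cong (Inverse.from f) eq) (Inverse.inverseʳ f refl)))
  (cong (Inverse.to f))
  (Inverse.to f x ≟ Inverse.to f y)

finite-Maybe : ∀ {A} → Finite A → Finite (Maybe A)
finite-Maybe {A} (n , f) = suc n , mk↔ₛ′ to from to∘from from∘to
  where
  to : Maybe A → Fin (suc n)
  to nothing  = zero
  to (just x) = suc (Inverse.to f x)

  from : Fin (suc n) → Maybe A
  from zero    = nothing
  from (suc i) = just (Inverse.from f i)

  to∘from : ∀ i → to (from i) ≡ i
  to∘from zero    = refl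
  to∘from (suc i) = cong suc (Inverse.inverseˡ f refl)

  from∘to : ∀ x → from (to x) ≡ x
  from∘to nothing  = refl
  from∘to (just x) = cong just (Inverse.inverseʳ f refl)

finite-⊎ : ∀ {A B} → Finite A → Finite B → Finite (A ⊎ B)
finite-⊎ (m , f) (n , g) = m + n , ↔-sym +↔⊎ ↔-∘ (f ⊎-↔ g)

finite-Refinement : ∀ {n} {P : Fin n → Set} → U.Decidable P → Finite [ x ∈ Fin n ∣ P x ]
finite-Refinement {zero} P? = 0 , mk↔ₛ′ (λ { (() , _) }) (λ ()) (λ ()) (λ { (() , _) })
finite-Refinement {suc n} {P} P? with P? zero | finite-Refinement (P? ∘ suc)
... | yes p | m , f = suc m , mk↔ₛ′ to from to∘from from∘to
  where
  to : [ x ∈ Fin (suc n) ∣ P x ] → Fin (suc m)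
  to (zero  , _) = zero
  to (suc i , q) = suc (Inverse.to f (i , q))

  from : Fin (suc m) → [ x ∈ Fin (suc n) ∣ P x ]
  from zero    = zero , [ p ]
  from (suc k) = let (i , q) = Inverse.from f k in suc i , q

  to∘from : ∀ k → to (from k) ≡ k
  to∘from zero    = refl
  to∘from (suc k) = cong suc (Inverse.inverseˡ f refl)

  from∘to : ∀ x → from (to x) ≡ x
  from∘to (zero  , _) = refl
  from∘to (suc i , q) = cong (λ { (j , r) → suc j , r }) (Inverse.inverseʳ f {i , q} refl)
... | no ¬p | m , f = m , mk↔ₛ′ to from to∘from from∘to
  where
  to : [ x ∈ Fin (suc n) ∣ P x ] → Fin m
  to (zero  , [ p ]) = ⊥-elim-irr (¬p p)
  to (suc i , q)     = Inverse.to f (i , q)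

  from : Fin m → [ x ∈ Fin (suc n) ∣ P x ]
  from k = let (i , q) = Inverse.from f k in suc i , q

  to∘from : ∀ k → to (from k) ≡ k
  to∘from k = Inverse.inverseˡ f refl

  from∘to : ∀ x → from (to x) ≡ x
  from∘to (zero  , [ p ]) = ⊥-elim-irr (¬p p)
  from∘to (suc i , q)     = cong (λ { (j , r) → suc j , r }) (Inverse.inverseʳ f {i , q} refl)

realise : ∀ R → Finite (Vertexʳ R) → Decidable (Arcʳ R) → (∀ v → ¬ Arcʳ R v v) →
          ∃ λ H → Iso ⟦ H ⟧ R
realise R (n , f) arc? loopless =
  record
    { order    = n
    ; arc      = λ u v → ⌊ arc? (Inverse.from f u) (Inverse.from f v) ⌋
    ; loopless = λ v a → loopless _ (toWitness a)
    } ,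
  ≅⇒Iso (↔-sym f , λ u v → mk⇔ toWitness fromWitness)

-- Identification

abstract
  identify-realisable : ∀ G (I : Subset (Digraph.order G)) → ∃ λ H → Iso ⟦ H ⟧ (identify G I)
  identify-realisable G I = realise (identify G I)
    (finite-Maybe (finite-Refinement (λ u → ¬? (u ∈? I)))) arc? loopless
    where
    arc? : Decidable (Arcʳ (identify G I))
    arc? (just x) (just y) = T? _
    arc? nothing  (just y) = any? λ u → u ∈? I ×-dec T? _
    arc? (just x) nothing  = any? λ u → u ∈? I ×-dec T? _
    arc? nothing  nothing  = no λ ()

    loopless : ∀ v → ¬ Arcʳ (identify G I) v v
    loopless (just x) = Digraph.loopless G _
    loopless nothing  = λ ()

∈-tabulate⁺ : ∀ {n} {f : Fin n → Bool} {x} → f x ≡ true → x ∈ tabulate f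
∈-tabulate⁺ {f = f} {x} eq = lookup⇒[]= x _ (trans (lookup∘tabulate f x) eq)

∈-tabulate⁻ : ∀ {n} {f : Fin n → Bool} {x} → x ∈ tabulate f → f x ≡ true
∈-tabulate⁻ {f = f} {x} x∈ = trans (sym (lookup∘tabulate f x)) ([]=⇒lookup x∈)

preimage : ∀ {m n} → (Fin n → Fin m) → Subset m → Subset n
preimage f I = tabulate (lookup I ∘ f)

∈-preimage⁺ : ∀ {m n} {f : Fin n → Fin m} {I x} → f x ∈ I → x ∈ preimage f I
∈-preimage⁺ fx∈I = ∈-tabulate⁺ ([]=⇒lookup fx∈I)

∈-preimage⁻ : ∀ {m n} {f : Fin n → Fin m} {I x} → x ∈ preimage f I → f x ∈ I
∈-preimage⁻ x∈ = lookup⇒[]= _ _ (∈-tabulate⁻ x∈)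

mapRefinement : ∀ {A B : Set} {P : A → Set} {Q : B → Set} (f : A → B) →
                .(∀ {x} → P x → Q (f x)) → [ x ∈ A ∣ P x ] → [ y ∈ B ∣ Q y ]
mapRefinement f p⇒q (x , [ p ]) = f x , [ p⇒q p ]

value-injective : ∀ {A : Set} {P : A → Set} {x y : [ x ∈ A ∣ P x ]} → value x ≡ value y → x ≡ y
value-injective refl = refl

identify-cong : ∀ {G G′} (i : Iso ⟦ G ⟧ ⟦ G′ ⟧) I →
                Iso (identify G I) (identify G′ (preimage (Iso.from i) I))
identify-cong {G} {G′} i I = record
  { to = to′ ; from = from′ ; to∘from = to∘from′ ; from∘to = from∘to′
  ; arc→ = λ {u} {v} → arc→′ u v ; arc← = λ {u} {v} → arc←′ u v }
  where
  open Iso i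
  I′ = preimage from I

  to-∈ : ∀ {u} → u ∈ I → to u ∈ I′
  to-∈ u∈I = ∈-preimage⁺ {f = from} (subst (_∈ I) (sym (from∘to _)) u∈I)

  to-∉ : ∀ {u} → u ∉ I → to u ∉ I′
  to-∉ u∉I to∈ = u∉I (subst (_∈ I) (from∘to _) (∈-preimage⁻ {f = from} to∈))

  from-∉ : ∀ {u} → u ∉ I′ → from u ∉ I
  from-∉ u∉I′ from∈ = u∉I′ (∈-preimage⁺ {f = from} from∈)

  to′ : Vertexʳ (identify G I) → Vertexʳ (identify G′ I′)
  to′ = mapMaybe (mapRefinement to to-∉)

  from′ : Vertexʳ (identify G′ I′) → Vertexʳ (identify G I)
  from′ = mapMaybe (mapRefinement from from-∉)

  to∘from′ : ∀ y → to′ (from′ y) ≡ y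
  to∘from′ (just y) = cong just (value-injective (to∘from (value y)))
  to∘from′ nothing  = refl

  from∘to′ : ∀ x → from′ (to′ x) ≡ x
  from∘to′ (just x) = cong just (value-injective (from∘to (value x)))
  from∘to′ nothing  = refl

  arc→′ : ∀ u v → Arcʳ (identify G I) u v → Arcʳ (identify G′ I′) (to′ u) (to′ v)
  arc→′ (just x) (just y) a             = arc→ a
  arc→′ nothing  (just y) (u , u∈I , a) = to u , to-∈ u∈I , arc→ a
  arc→′ (just x) nothing  (u , u∈I , a) = to u , to-∈ u∈I , arc→ a

  arc←′ : ∀ u v → Arcʳ (identify G′ I′) u v → Arcʳ (identify G I) (from′ u) (from′ v)
  arc←′ (just x) (just y) a              = arc← a
  arc←′ nothing  (just y) (u , u∈I′ , a) = from u , ∈-preimage⁻ {f = from} u∈I′ , arc← a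
  arc←′ (just x) nothing  (u , u∈I′ , a) = from u , ∈-preimage⁻ {f = from} u∈I′ , arc← a

-- Joins

collapse-injective : ∀ {n} (v : Fin n) {x y} → collapse v x ≡ collapse v y → x ≡ y
collapse-injective v {x} {y} eq with x ≟ v | y ≟ v
collapse-injective v eq   | yes refl | yes refl = refl
collapse-injective v refl | no _     | no _     = refl

collapse-self : ∀ {n} (v : Fin n) → collapse v v ≡ nothing
collapse-self v with v ≟ v
... | yes _  = refl
... | no v≢v = contradiction refl v≢v

collapse-other : ∀ {n} {v x : Fin n} (x≢v : x ≢ v) → collapse v x ≡ just (x , [ x≢v ])
collapse-other {v = v} {x} x≢v with x ≟ v
... | yes x≡v = contradiction x≡v x≢v
... | no _    = refl

mapMaybe-injective : ∀ {A B : Set} {f : A → B} → (∀ {x y} → f x ≡ f y → x ≡ y) →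
                     ∀ {x y} → mapMaybe f x ≡ mapMaybe f y → x ≡ y
mapMaybe-injective inj {just x}  {just y}  eq = cong just (inj (just-inj eq))
  where
  just-inj : ∀ {A : Set} {x y : A} → just x ≡ just y → x ≡ y
  just-inj refl = refl
mapMaybe-injective inj {nothing} {nothing} eq = refl

private
  inj₁-inj : ∀ {A B : Set} {x y : A} → inj₁ {B = B} x ≡ inj₁ y → x ≡ y
  inj₁-inj refl = refl

  inj₂-inj : ∀ {A B : Set} {x y : B} → inj₂ {A = A} x ≡ inj₂ y → x ≡ y
  inj₂-inj refl = refl

module Join (G₁ : Digraph) (u₁ v₁ : Vertex G₁) (G₂ : Digraph) (v₂ u₂ : Vertex G₂) where

  left : Vertex G₁ → JoinVertex G₁ u₁ v₁ G₂ v₂ u₂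
  left = ι₁ G₁ u₁ v₁ G₂ v₂ u₂

  right : Vertex G₂ → JoinVertex G₁ u₁ v₁ G₂ v₂ u₂
  right = ι₂ G₁ u₁ v₁ G₂ v₂ u₂

  joined : RawDigraph
  joined = hajósJoin G₁ u₁ v₁ G₂ v₂ u₂

  left-injective : ∀ {x y} → left x ≡ left y → x ≡ y
  left-injective = collapse-injective v₁ ∘ mapMaybe-injective inj₁-inj

  right-injective : ∀ {x y} → right x ≡ right y → x ≡ y
  right-injective = collapse-injective v₂ ∘ mapMaybe-injective inj₂-inj

  glued : left v₁ ≡ right v₂
  glued = trans (cong (mapMaybe inj₁) (collapse-self v₁))
                (sym (cong (mapMaybe inj₂) (collapse-self v₂)))

  left≡right : ∀ {x y} → left x ≡ right y → x ≡ v₁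
  left≡right {x} {y} eq with x ≟ v₁ | y ≟ v₂
  left≡right eq | yes x≡v₁ | _     = x≡v₁
  left≡right () | no _     | yes _
  left≡right () | no _     | no _

  finite : Finite (Vertexʳ joined)
  finite = finite-Maybe (finite-⊎ (finite-Refinement (λ x → ¬? (x ≟ v₁)))
                                  (finite-Refinement (λ x → ¬? (x ≟ v₂))))

  arc? : Decidable (Arcʳ joined)
  arc? p q =
          any? (λ x → any? λ y → T? _ ×-dec ¬? (x ≟ u₁ ×-dec y ≟ v₁) ×-dec (p ≟ᵥ left x) ×-dec (q ≟ᵥ left y))
    ⊎-dec any? (λ x → any? λ y → T? _ ×-dec ¬? (x ≟ v₂ ×-dec y ≟ u₂) ×-dec (p ≟ᵥ right x) ×-dec (q ≟ᵥ right y))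
    ⊎-dec ((p ≟ᵥ left u₁) ×-dec (q ≟ᵥ right u₂))
    where
    _≟ᵥ_ : DecidableEquality (Vertexʳ joined)
    _≟ᵥ_ = finite-≟ finite

  loopless : Arc G₁ u₁ v₁ → ∀ p → ¬ Arcʳ joined p p
  loopless a p (inj₁ (x , y , b , _ , eq , eq′)) =
    Digraph.loopless G₁ x (subst (Arc G₁ x) (sym (left-injective (trans (sym eq) eq′))) b)
  loopless a p (inj₂ (inj₁ (x , y , b , _ , eq , eq′))) =
    Digraph.loopless G₂ x (subst (Arc G₂ x) (sym (right-injective (trans (sym eq) eq′))) b)
  loopless a p (inj₂ (inj₂ (eq , eq′))) =
    Digraph.loopless G₁ u₁ (subst (Arc G₁ u₁) (sym (left≡right {u₁} {u₂} (trans (sym eq) eq′))) a)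

  abstract
    realisable : Arc G₁ u₁ v₁ → ∃ λ H → Iso ⟦ H ⟧ joined
    realisable a = realise joined finite arc? (loopless a)

  copair : {X : Set} → (Vertex G₁ → X) → (Vertex G₂ → X) → Vertexʳ joined → X
  copair f g nothing         = f v₁
  copair f g (just (inj₁ x)) = f (value x)
  copair f g (just (inj₂ x)) = g (value x)

  module _ {X : Set} {f : Vertex G₁ → X} {g : Vertex G₂ → X} where

    copair-left : ∀ x → copair f g (left x) ≡ f x
    copair-left x with x ≟ v₁
    ... | yes refl = refl
    ... | no _     = refl

    copair-right : f v₁ ≡ g v₂ → ∀ x → copair f g (right x) ≡ g x
    copair-right fg x with x ≟ v₂
    ... | yes refl = fg
    ... | no _     = refl

    copair-unique : (h : Vertexʳ joined → X) → (∀ x → h (left x) ≡ f x) → (∀ x → h (right x) ≡ g x) →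
                    ∀ p → copair f g p ≡ h p
    copair-unique h hf hg nothing = trans (sym (hf v₁)) (cong h (cong (mapMaybe inj₁) (collapse-self v₁)))
    copair-unique h hf hg (just (inj₁ (x , [ x≢v₁ ]))) with x ≟ v₁
    ... | yes x≡v₁ = ⊥-elim-irr (x≢v₁ x≡v₁)
    ... | no x≢    = trans (sym (hf x)) (cong h (cong (mapMaybe inj₁) (collapse-other x≢)))
    copair-unique h hf hg (just (inj₂ (x , [ x≢v₂ ]))) with x ≟ v₂
    ... | yes x≡v₂ = ⊥-elim-irr (x≢v₂ x≡v₂)
    ... | no x≢    = trans (sym (hg x)) (cong h (cong (mapMaybe inj₂) (collapse-other x≢)))

module _ {G₁ G₁′ G₂ G₂′ : Digraph} (i₁ : Iso ⟦ G₁ ⟧ ⟦ G₁′ ⟧) (i₂ : Iso ⟦ G₂ ⟧ ⟦ G₂′ ⟧)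
         (u₁ v₁ : Vertex G₁) (v₂ u₂ : Vertex G₂) where
  private
    module I₁ = Iso i₁
    module I₂ = Iso i₂
    module J  = Join G₁ u₁ v₁ G₂ v₂ u₂
    module J′ = Join G₁′ (I₁.to u₁) (I₁.to v₁) G₂′ (I₂.to v₂) (I₂.to u₂)

    to : Vertexʳ J.joined → Vertexʳ J′.joined
    to = J.copair (J′.left ∘ I₁.to) (J′.right ∘ I₂.to)

    from : Vertexʳ J′.joined → Vertexʳ J.joined
    from = J′.copair (J.left ∘ I₁.from) (J.right ∘ I₂.from)

    to-left : ∀ x → to (J.left x) ≡ J′.left (I₁.to x)
    to-left = J.copair-left

    to-right : ∀ x → to (J.right x) ≡ J′.right (I₂.to x)
    to-right = J.copair-right J′.glued

    from-left : ∀ x → from (J′.left x) ≡ J.left (I₁.from x)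
    from-left = J′.copair-left

    from-right : ∀ x → from (J′.right x) ≡ J.right (I₂.from x)
    from-right = J′.copair-right
      (trans (cong J.left (I₁.from∘to v₁)) (trans J.glued (cong J.right (sym (I₂.from∘to v₂)))))

    to∘from : ∀ y → to (from y) ≡ y
    to∘from y = trans (sym (J′.copair-unique (to ∘ from)
        (λ x → trans (cong to (from-left x)) (trans (to-left _) (cong J′.left (I₁.to∘from x))))
        (λ x → trans (cong to (from-right x)) (trans (to-right _) (cong J′.right (I₂.to∘from x))))
        y))
      (J′.copair-unique id (λ _ → refl) (λ _ → refl) y)

    from∘to : ∀ x → from (to x) ≡ x
    from∘to x = trans (sym (J.copair-unique (from ∘ to)
        (λ x → trans (cong from (to-left x)) (trans (from-left _) (cong J.left (I₁.from∘to x))))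
        (λ x → trans (cong from (to-right x)) (trans (from-right _) (cong J.right (I₂.from∘to x))))
        x))
      (J.copair-unique id (λ _ → refl) (λ _ → refl) x)

    arc→ : ∀ {p q} → Arcʳ J.joined p q → Arcʳ J′.joined (to p) (to q)
    arc→ (inj₁ (x , y , a , ¬e , refl , refl)) =
      inj₁ (I₁.to x , I₁.to y , I₁.arc→ a , (λ (ex , ey) → ¬e (I₁.to-injective ex , I₁.to-injective ey)) , to-left x , to-left y)
    arc→ (inj₂ (inj₁ (x , y , a , ¬e , refl , refl))) =
      inj₂ (inj₁ (I₂.to x , I₂.to y , I₂.arc→ a , (λ (ex , ey) → ¬e (I₂.to-injective ex , I₂.to-injective ey)) , to-right x , to-right y))
    arc→ (inj₂ (inj₂ (refl , refl))) = inj₂ (inj₂ (to-left u₁ , to-right u₂))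

    arc← : ∀ {p q} → Arcʳ J′.joined p q → Arcʳ J.joined (from p) (from q)
    arc← (inj₁ (x , y , a , ¬e , refl , refl)) =
      inj₁ (I₁.from x , I₁.from y , I₁.arc← a ,
            (λ { (refl , refl) → ¬e (sym (I₁.to∘from x) , sym (I₁.to∘from y)) }) , from-left x , from-left y)
    arc← (inj₂ (inj₁ (x , y , a , ¬e , refl , refl))) =
      inj₂ (inj₁ (I₂.from x , I₂.from y , I₂.arc← a ,
            (λ { (refl , refl) → ¬e (sym (I₂.to∘from x) , sym (I₂.to∘from y)) }) , from-right x , from-right y))
    arc← (inj₂ (inj₂ (refl , refl))) =
      inj₂ (inj₂ (trans (from-left _) (cong J.left (I₁.from∘to u₁)) , trans (from-right _) (cong J.right (I₂.from∘to u₂))))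

  join-cong : Iso J.joined J′.joined
  join-cong = record
    { to = to ; from = from ; to∘from = to∘from ; from∘to = from∘to ; arc→ = arc→ ; arc← = arc← }

-- Decidability of obtainability

anyVec? : ∀ {m} n {P : Vec (Fin m) n → Set} → U.Decidable P → Dec (∃ P)
anyVec? zero    P? = map′ (λ p → [] , p) (λ { ([] , p) → p }) (P? [])
anyVec? (suc n) P? = map′ (λ { (x , xs , p) → x ∷ xs , p }) (λ { (x ∷ xs , p) → x , xs , p })
  (any? λ x → anyVec? n (P? ∘ (x ∷_)))

iso? : ∀ G H → Dec (Iso ⟦ G ⟧ ⟦ H ⟧)
iso? G H = map′ decode encode (anyVec? G.order λ t → anyVec? H.order (isoPair? t))
  where
  module G = Digraph G
  module H = Digraph H

  IsoPair : Vec (Fin H.order) G.order → Vec (Fin G.order) H.order → Set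
  IsoPair t f = (∀ y → lookup t (lookup f y) ≡ y) × (∀ x → lookup f (lookup t x) ≡ x)
              × (∀ u v → Arc G u v → Arc H (lookup t u) (lookup t v))
              × (∀ u v → Arc H u v → Arc G (lookup f u) (lookup f v))

  isoPair? : Decidable IsoPair
  isoPair? t f = all? (λ y → _ ≟ _) ×-dec all? (λ x → _ ≟ _)
    ×-dec all? (λ u → all? λ v → T? _ →-dec T? _)
    ×-dec all? (λ u → all? λ v → T? _ →-dec T? _)

  decode : ∃ (λ t → ∃ (IsoPair t)) → Iso ⟦ G ⟧ ⟦ H ⟧
  decode (t , f , tf , ft , a→ , a←) = record
    { to = lookup t ; from = lookup f ; to∘from = tf ; from∘to = ft ; arc→ = a→ _ _ ; arc← = a← _ _ }

  encode : Iso ⟦ G ⟧ ⟦ H ⟧ → ∃ (λ t → ∃ (IsoPair t))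
  encode i = tabulate to , tabulate from ,
    (λ y → trans (t≡ _) (trans (cong to (f≡ y)) (to∘from y))) ,
    (λ x → trans (f≡ _) (trans (cong from (t≡ x)) (from∘to x))) ,
    (λ u v a → subst₂ (Arc H) (sym (t≡ u)) (sym (t≡ v)) (arc→ a)) ,
    (λ u v a → subst₂ (Arc G) (sym (f≡ u)) (sym (f≡ v)) (arc← a))
    where
    open Iso i

    t≡ : ∀ x → lookup (tabulate to) x ≡ to x
    t≡ = lookup∘tabulate to

    f≡ : ∀ y → lookup (tabulate from) y ≡ from y
    f≡ = lookup∘tabulate from

_≋_ : List Digraph → List Digraph → Set
_≋_ = Pointwise (λ G H → Iso ⟦ G ⟧ ⟦ H ⟧)

≋-refl : ∀ {Gs} → Gs ≋ Gs
≋-refl {[]}    = []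
≋-refl {_ ∷ _} = Iso-refl ∷ ≋-refl

∈-≋ : ∀ {Gs Hs G} → Gs ≋ Hs → G ∈ₗ Gs → ∃ λ H → H ∈ₗ Hs × Iso ⟦ G ⟧ ⟦ H ⟧
∈-≋ (i ∷ is) (here refl) = _ , here refl , i
∈-≋ (i ∷ is) (there G∈)  = let H , H∈ , j = ∈-≋ is G∈ in H , there H∈ , j

guarded : ∀ {A B : Set} → Dec A → (A → Dec B) → Dec (A × B)
guarded (no ¬a) _  = no (¬a ∘ proj₁)
guarded (yes a) B? = map′ (a ,_) proj₂ (B? a)

module Search (r : ℕ) (H : Digraph) where

  Operation : List Digraph → Digraph → Set
  Operation Gs = HajósOperation (AvailableFrom r Gs)

  available-≋ : ∀ {Gs Hs G} → Gs ≋ Hs → AvailableFrom r Gs G →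
                ∃ λ G′ → AvailableFrom r Hs G′ × Iso ⟦ G ⟧ ⟦ G′ ⟧
  available-≋ is (inj₁ refl) = _ , inj₁ refl , Iso-refl
  available-≋ is (inj₂ G∈)   = let G′ , G′∈ , i = ∈-≋ is G∈ in G′ , inj₂ G′∈ , i

  operation-≋ : ∀ {Gs Hs J} → Gs ≋ Hs → Operation Gs J → Operation Hs J
  operation-≋ {J = J} is (identification G G∈ I (x , x∈I) indep i) =
    let G′ , G′∈ , j = available-≋ is G∈
        open Iso j
    in identification G′ G′∈ (preimage from I)
         (to x , ∈-preimage⁺ {f = from} (subst (_∈ I) (sym (from∘to x)) x∈I))
         (λ u v u∈ v∈ a → indep _ _ (∈-preimage⁻ {f = from} u∈) (∈-preimage⁻ {f = from} v∈) (arc← a))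
         (Iso⇒≅ (Iso-trans (≅⇒Iso {⟦ J ⟧} {identify G I} i) (identify-cong {G} {G′} j I)))
  operation-≋ {J = J} is (join G₁ G₂ G₁∈ G₂∈ u₁ v₁ a₁ v₂ u₂ a₂ i) =
    let G₁′ , G₁′∈ , j₁ = available-≋ is G₁∈
        G₂′ , G₂′∈ , j₂ = available-≋ is G₂∈
    in join G₁′ G₂′ G₁′∈ G₂′∈ _ _ (Iso.arc→ j₁ a₁) _ _ (Iso.arc→ j₂ a₂)
         (Iso⇒≅ (Iso-trans (≅⇒Iso {⟦ J ⟧} {hajósJoin G₁ u₁ v₁ G₂ v₂ u₂} i)
                           (join-cong {G₁} {G₁′} {G₂} {G₂′} j₁ j₂ u₁ v₁ v₂ u₂)))

  Reaches : ℕ → List Digraph → Set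
  Reaches zero    Gs = ∃ λ G → AvailableFrom r Gs G × Iso ⟦ H ⟧ ⟦ G ⟧
  Reaches (suc k) Gs = ∃ λ J → Operation Gs J × Reaches k (J ∷ Gs)

  reaches-≋ : ∀ k {Gs Hs} → Gs ≋ Hs → Reaches k Gs → Reaches k Hs
  reaches-≋ zero    is (G , G∈ , i) =
    let G′ , G′∈ , j = available-≋ is G∈ in G′ , G′∈ , Iso-trans i j
  reaches-≋ (suc k) is (J , op , reach) = J , operation-≋ is op , reaches-≋ k (Iso-refl ∷ is) reach

  Any-available : ∀ {P : Digraph → Set} {Gs} → Any P (D (K r) ∷ Gs) → ∃ λ G → AvailableFrom r Gs G × P G
  Any-available (here p)  = _ , inj₁ refl , p
  Any-available (there p) = let G , G∈ , q = find p in G , inj₂ G∈ , q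

  available-Any : ∀ {P : Digraph → Set} {Gs G} → AvailableFrom r Gs G → P G → Any P (D (K r) ∷ Gs)
  available-Any (inj₁ refl) p = here p
  available-Any (inj₂ G∈)   p = there (lose G∈ p)

  anyAvailable? : ∀ {P : Digraph → Set} Gs → U.Decidable P → Dec (∃ λ G → AvailableFrom r Gs G × P G)
  anyAvailable? Gs P? = map′ Any-available (λ (_ , G∈ , p) → available-Any G∈ p) (anyₗ? P? (D (K r) ∷ Gs))

  -- Isomorphic intermediate digraphs reach the same targets, so one
  -- realisation of each raw digraph is all that has to be tried.
  realisation? : ∀ k {Gs R} → U.Decidable (Reaches k) → (∃ λ J → Iso ⟦ J ⟧ R) →
                 Dec (∃ λ J → Iso ⟦ J ⟧ R × Reaches k (J ∷ Gs))
  realisation? k {Gs} reaches? (J , i) = map′ (λ reach → J , i , reach)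
    (λ (J′ , i′ , reach) → reaches-≋ k (Iso-trans i′ (Iso-sym i) ∷ ≋-refl) reach)
    (reaches? (J ∷ Gs))

  reaches? : ∀ k → U.Decidable (Reaches k)
  reaches? zero    Gs = anyAvailable? Gs (iso? H)
  reaches? (suc k) Gs = map′ decode encode
    (anyAvailable? Gs (λ G → anySubset? λ I → nonempty? I
        ×-dec all? (λ u → all? λ v → u ∈? I →-dec (v ∈? I →-dec ¬? (T? _)))
        ×-dec realisation? k (reaches? k) (identify-realisable G I))
     ⊎-dec
     anyAvailable? Gs λ G₁ → anyAvailable? Gs λ G₂ →
       any? λ u₁ → any? λ v₁ → any? λ v₂ → any? λ u₂ →
         T? (Digraph.arc G₂ v₂ u₂) ×-dec
         guarded (T? (Digraph.arc G₁ u₁ v₁))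
                 (realisation? k (reaches? k) ∘ Join.realisable G₁ u₁ v₁ G₂ v₂ u₂))
    where
    Identified Joined : Set
    Identified = ∃ λ G → AvailableFrom r Gs G × ∃ λ I → Nonempty I × Independent G I
      × ∃ λ J → Iso ⟦ J ⟧ (identify G I) × Reaches k (J ∷ Gs)
    Joined = ∃ λ G₁ → AvailableFrom r Gs G₁ × ∃ λ G₂ → AvailableFrom r Gs G₂
      × ∃ λ u₁ → ∃ λ v₁ → ∃ λ v₂ → ∃ λ u₂ → Arc G₂ v₂ u₂ × Arc G₁ u₁ v₁
      × ∃ λ J → Iso ⟦ J ⟧ (hajósJoin G₁ u₁ v₁ G₂ v₂ u₂) × Reaches k (J ∷ Gs)

    decode : Identified ⊎ Joined → Reaches (suc k) Gs
    decode (inj₁ (G , G∈ , I , ne , indep , J , i , reach)) =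
      J , identification G G∈ I ne indep (Iso⇒≅ i) , reach
    decode (inj₂ (G₁ , G₁∈ , G₂ , G₂∈ , u₁ , v₁ , v₂ , u₂ , a₂ , a₁ , J , i , reach)) =
      J , join G₁ G₂ G₁∈ G₂∈ u₁ v₁ a₁ v₂ u₂ a₂ (Iso⇒≅ i) , reach

    encode : Reaches (suc k) Gs → Identified ⊎ Joined
    encode (J , identification G G∈ I ne indep i , reach) =
      inj₁ (G , G∈ , I , ne , indep , J , ≅⇒Iso {⟦ J ⟧} {identify G I} i , reach)
    encode (J , join G₁ G₂ G₁∈ G₂∈ u₁ v₁ a₁ v₂ u₂ a₂ i , reach) =
      inj₂ (G₁ , G₁∈ , G₂ , G₂∈ , u₁ , v₁ , v₂ , u₂ , a₂ , a₁ , J ,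
            ≅⇒Iso {⟦ J ⟧} {hajósJoin G₁ u₁ v₁ G₂ v₂ u₂} i , reach)

  reaches⇒obtainable : ∀ k {Gs} → HajósConstruction r Gs → Reaches k Gs → ObtainableIn r H (k + length Gs)
  reaches⇒obtainable zero    con (G , G∈ , i)      = _ , con , refl , G , G∈ , Iso⇒≅ i
  reaches⇒obtainable (suc k) con (J , op , reach) =
    subst (ObtainableIn r H) (+-suc k _) (reaches⇒obtainable k (op ∷ con) reach)

  unwind : ∀ k {Gs} → HajósConstruction r Gs → Reaches k Gs → Reaches (length Gs + k) []
  unwind k []         reach = reach
  unwind k {_ ∷ Gs} (op ∷ con) reach =
    subst (λ l → Reaches l []) (+-suc (length Gs) k) (unwind (suc k) con (_ , op , reach))

  obtainable? : U.Decidable (ObtainableIn r H)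
  obtainable? k = map′
    (λ reach → subst (ObtainableIn r H) (+-identityʳ k) (reaches⇒obtainable k [] reach))
    (λ { (Gs , con , refl , G , G∈ , i) →
         subst (λ l → Reaches l []) (+-identityʳ _) (unwind 0 con (G , G∈ , ≅⇒Iso {⟦ H ⟧} {⟦ G ⟧} i)) })
    (reaches? k [])

minimum : ∀ {P : ℕ → Set} → U.Decidable P → ∀ k → P k → ∃ λ h → IsMinimum P h × h ≤ k
minimum P? zero    p = 0 , (p , λ _ _ → z≤n) , z≤n
minimum P? (suc k) p with P? 0
... | yes p₀ = 0 , (p₀ , λ _ _ → z≤n) , z≤n
... | no ¬p₀ =
  let h , (q , least) , h≤k = minimum (P? ∘ suc) k p
  in suc h , (q , λ { zero p₀ → contradiction p₀ ¬p₀ ; (suc l) pₗ → s≤s (least l pₗ) }) , s≤s h≤k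

-- Two-colourings certified by a rank

Colourable : RawDigraph → Set
Colourable G = Σ (Vertexʳ G → Bool) λ c → Σ (Vertexʳ G → ℕ) λ rank →
  ∀ {x y} → Arcʳ G x y → c x ≡ c y → rank x < rank y

colourable-pullback : ∀ {G H} (f : Vertexʳ G → Vertexʳ H) →
                      (∀ {x y} → Arcʳ G x y → Arcʳ H (f x) (f y)) → Colourable H → Colourable G
colourable-pullback f hom (c , rank , inc) = c ∘ f , rank ∘ f , inc ∘ hom

quotient : ∀ G (I : Subset (Digraph.order G)) → Vertex G → Vertexʳ (identify G I)
quotient G I u with u ∈? I
... | yes _  = nothing
... | no u∉I = just (u , [ u∉I ])

quotient-arc : ∀ G {I} → Independent G I → ∀ {u v} → Arc G u v →
               Arcʳ (identify G I) (quotient G I u) (quotient G I v)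
quotient-arc G {I} indep {u} {v} a with u ∈? I | v ∈? I
... | yes u∈I | yes v∈I = indep u v u∈I v∈I a
... | yes u∈I | no _    = u , u∈I , a
... | no _    | yes v∈I = v , v∈I , a
... | no _    | no _    = a

join-colourable : ∀ G₁ u₁ v₁ G₂ v₂ u₂ → Colourable (hajósJoin G₁ u₁ v₁ G₂ v₂ u₂) →
                  Colourable ⟦ G₁ ⟧ ⊎ Colourable ⟦ G₂ ⟧
join-colourable G₁ u₁ v₁ G₂ v₂ u₂ (c , rank , inc) = choose
  (c (left u₁) ≟ᵇ c (left v₁) →-dec rank (left u₁) <? rank (left v₁))
  (c (right v₂) ≟ᵇ c (right u₂) →-dec rank (right v₂) <? rank (right u₂))
  where
  open Join G₁ u₁ v₁ G₂ v₂ u₂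

  on₁ : (c (left u₁) ≡ c (left v₁) → rank (left u₁) < rank (left v₁)) → Colourable ⟦ G₁ ⟧
  on₁ ok = c ∘ left , rank ∘ left , step
    where
    step : ∀ {x y} → Arc G₁ x y → c (left x) ≡ c (left y) → rank (left x) < rank (left y)
    step {x} {y} a with x ≟ u₁ ×-dec y ≟ v₁
    ... | yes (refl , refl) = ok
    ... | no ¬e             = inc (inj₁ (x , y , a , ¬e , refl , refl))

  on₂ : (c (right v₂) ≡ c (right u₂) → rank (right v₂) < rank (right u₂)) → Colourable ⟦ G₂ ⟧
  on₂ ok = c ∘ right , rank ∘ right , step
    where
    step : ∀ {x y} → Arc G₂ x y → c (right x) ≡ c (right y) → rank (right x) < rank (right y)
    step {x} {y} a with x ≟ v₂ ×-dec y ≟ u₂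
    ... | yes (refl , refl) = ok
    ... | no ¬e             = inc (inj₂ (inj₁ (x , y , a , ¬e , refl , refl)))

  choose : Dec (c (left u₁) ≡ c (left v₁) → rank (left u₁) < rank (left v₁)) →
           Dec (c (right v₂) ≡ c (right u₂) → rank (right v₂) < rank (right u₂)) →
           Colourable ⟦ G₁ ⟧ ⊎ Colourable ⟦ G₂ ⟧
  choose (yes ok) _        = inj₁ (on₁ ok)
  choose (no _)   (yes ok) = inj₂ (on₂ ok)
  choose (no bad₁) (no bad₂) = ⊥-elim (bad₁ λ c₁ → ⊥-elim (bad₂ λ c₂ →
    subst (λ p → rank p < rank (right u₂)) glued
      (≤-trans (s≤s (≮⇒≥ λ lt → bad₁ λ _ → lt))
        (inc (inj₂ (inj₂ (refl , refl))) (trans c₁ (trans (cong c glued) c₂))))))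

Bool-pigeonhole : (x y z : Bool) → x ≡ y ⊎ y ≡ z ⊎ x ≡ z
Bool-pigeonhole false false _     = inj₁ refl
Bool-pigeonhole true  true  _     = inj₁ refl
Bool-pigeonhole _     false false = inj₂ (inj₁ refl)
Bool-pigeonhole _     true  true  = inj₂ (inj₁ refl)
Bool-pigeonhole false true  false = inj₂ (inj₂ refl)
Bool-pigeonhole true  false true  = inj₂ (inj₂ refl)

D[K₃]-uncolourable : ¬ Colourable ⟦ D (K 3) ⟧
D[K₃]-uncolourable (c , rank , inc) with Bool-pigeonhole (c zero) (c (suc zero)) (c (suc (suc zero)))
... | inj₁ eq        = <-asym (inc {zero} {suc zero} _ eq) (inc {suc zero} {zero} _ (sym eq))
... | inj₂ (inj₁ eq) = <-asym (inc {suc zero} {suc (suc zero)} _ eq) (inc {suc (suc zero)} {suc zero} _ (sym eq))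
... | inj₂ (inj₂ eq) = <-asym (inc {zero} {suc (suc zero)} _ eq) (inc {suc (suc zero)} {zero} _ (sym eq))

available-uncolourable : ∀ {Gs G} → HajósConstruction 3 Gs → AvailableFrom 3 Gs G → ¬ Colourable ⟦ G ⟧
available-uncolourable con        (inj₁ refl)         = D[K₃]-uncolourable
available-uncolourable (_  ∷ con) (inj₂ (there G∈))   = available-uncolourable con (inj₂ G∈)
available-uncolourable {H ∷ _} (identification G G∈ I _ indep i ∷ con) (inj₂ (here refl)) =
  available-uncolourable con G∈
  ∘ colourable-pullback {⟦ G ⟧} {identify G I} (quotient G I) (quotient-arc G indep)
  ∘ colourable-pullback {identify G I} {⟦ H ⟧} from arc←
  where open Iso (≅⇒Iso {⟦ H ⟧} {identify G I} i)
available-uncolourable {H ∷ _} (join G₁ G₂ G₁∈ G₂∈ u₁ v₁ _ v₂ u₂ _ i ∷ con) (inj₂ (here refl)) colouring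
  with join-colourable G₁ u₁ v₁ G₂ v₂ u₂
         (colourable-pullback {hajósJoin G₁ u₁ v₁ G₂ v₂ u₂} {⟦ H ⟧} from arc← colouring)
  where open Iso (≅⇒Iso {⟦ H ⟧} {hajósJoin G₁ u₁ v₁ G₂ v₂ u₂} i)
... | inj₁ colouring₁ = available-uncolourable con G₁∈ colouring₁
... | inj₂ colouring₂ = available-uncolourable con G₂∈ colouring₂

-- Extending constructions

record After (k : ℕ) (Gs : List Digraph) (P : List Digraph → Set) : Set where
  constructor after
  field
    {digraphs}   : List Digraph
    construction : HajósConstruction 3 digraphs
    cost         : length digraphs ≤ k + length Gs
    keeps        : ∀ {G} → AvailableFrom 3 Gs G → AvailableFrom 3 digraphs G
    result       : P digraphs

done : ∀ {k Gs} {P : List Digraph → Set} → HajósConstruction 3 Gs → P Gs → After k Gs P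
done {k} con p = after con (m≤n+m _ k) id p

perform : ∀ {Gs H} {P : List Digraph → Set} → HajósConstruction 3 Gs →
          HajósOperation (AvailableFrom 3 Gs) H →
          (AvailableFrom 3 (H ∷ Gs) H → P (H ∷ Gs)) → After 1 Gs P
perform con op p = after (op ∷ con) ≤-refl (map⊎ id there) (p (inj₂ (here refl)))

bind : ∀ {k l Gs} {P Q : List Digraph → Set} → After k Gs P →
       (∀ {Hs} → HajósConstruction 3 Hs → (∀ {G} → AvailableFrom 3 Gs G → AvailableFrom 3 Hs G) →
        P Hs → After l Hs Q) →
       After (l + k) Gs Q
bind {k} {l} {Gs} (after con cost keeps p) f with f con keeps p
... | after con′ cost′ keeps′ q = after con′
  (≤-trans cost′ (≤-trans (+-monoʳ-≤ l cost) (≤-reflexive (sym (+-assoc l k (length Gs))))))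
  (keeps′ ∘ keeps) q

weaken : ∀ {k l Gs} {P : List Digraph → Set} → k ≤ l → After k Gs P → After l Gs P
weaken {Gs = Gs} k≤l (after con cost keeps p) = after con (≤-trans cost (+-monoˡ-≤ (length Gs) k≤l)) keeps p

mapAfter : ∀ {k Gs} {P Q : List Digraph → Set} → (∀ {Hs} → P Hs → Q Hs) → After k Gs P → After k Gs Q
mapAfter f (after con cost keeps p) = after con cost keeps (f p)

record Mapped {X : Set} (R : X → X → Set) (Gs : List Digraph) : Set where
  field
    graph     : Digraph
    available : AvailableFrom 3 Gs graph
    position  : Vertex graph → X
    arcs      : ∀ {x y} → Arc graph x y → R (position x) (position y)

InjectiveAt : ∀ {A X : Set} → (A → X) → X → Set
InjectiveAt f x = ∀ {p q} → f p ≡ x → f q ≡ x → p ≡ q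

module _ {X : Set} (_≟ₓ_ : DecidableEquality X) {R : X → X → Set} (irrefl : ∀ {x} → ¬ R x x) where
  open Mapped

  merge : ∀ {Gs} → HajósConstruction 3 Gs → (M : Mapped R Gs) → ∀ x →
          After 1 Gs λ Hs → Σ (Mapped R Hs) λ N → InjectiveAt (position N) x
            × (∀ {y} → InjectiveAt (position M) y → InjectiveAt (position N) y)
  merge {Gs} con M x with any? (λ u → position M u ≟ₓ x)
  ... | no empty = done con (M , (λ {p} eq _ → contradiction (p , eq) empty) , id)
  ... | yes (u₀ , u₀-fibre) = perform con
      (identification G (available M) I (u₀ , fibre⁺ u₀-fibre) indep (Iso⇒≅ i))
      (λ H∈ → merged H∈ , injective , λ inj → keeps-injective inj)
    where
    G = graph M
    φ = position M

    I : Subset (Digraph.order G)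
    I = tabulate λ u → does (φ u ≟ₓ x)

    fibre⁺ : ∀ {u} → φ u ≡ x → u ∈ I
    fibre⁺ {u} eq = ∈-tabulate⁺ (dec-true (φ u ≟ₓ x) eq)

    fibre⁻ : ∀ {u} → u ∈ I → φ u ≡ x
    fibre⁻ {u} u∈I with φ u ≟ₓ x | ∈-tabulate⁻ {f = λ u → does (φ u ≟ₓ x)} u∈I
    ... | yes eq | _ = eq

    indep : Independent G I
    indep u v u∈I v∈I a = irrefl (subst₂ R (fibre⁻ u∈I) (fibre⁻ v∈I) (arcs M a))

    H = proj₁ (identify-realisable G I)
    i = proj₂ (identify-realisable G I)
    open Iso i

    φ′ : Vertexʳ (identify G I) → X
    φ′ nothing  = x
    φ′ (just u) = φ (value u)

    arcs′ : ∀ p q → Arcʳ (identify G I) p q → R (φ′ p) (φ′ q)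
    arcs′ (just _) (just _) a             = arcs M a
    arcs′ nothing  (just _) (u , u∈I , a) = subst (λ z → R z _) (fibre⁻ u∈I) (arcs M a)
    arcs′ (just _) nothing  (u , u∈I , a) = subst (R _) (fibre⁻ u∈I) (arcs M a)

    merged : ∀ {Hs} → AvailableFrom 3 Hs H → Mapped R Hs
    merged H∈ = record
      { graph = H ; available = H∈ ; position = φ′ ∘ to ; arcs = λ {p} {q} a → arcs′ (to p) (to q) (arc→ a) }

    injective′ : InjectiveAt φ′ x
    injective′ {nothing}           {nothing}           _  _   = refl
    injective′ {just (_ , [ u∉ ])} {_}                 eq _   = ⊥-elim-irr (u∉ (fibre⁺ eq))
    injective′ {nothing}           {just (_ , [ u∉ ])} _  eq  = ⊥-elim-irr (u∉ (fibre⁺ eq))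

    injective : InjectiveAt (φ′ ∘ to) x
    injective eq eq′ = to-injective (injective′ eq eq′)

    keeps′ : ∀ {y} → InjectiveAt φ y → InjectiveAt φ′ y
    keeps′ inj {nothing} {nothing} _  _    = refl
    keeps′ inj {nothing} {just _}  eq eq′  = injective′ refl (trans eq′ (sym eq))
    keeps′ inj {just _}  {nothing} eq eq′  = injective′ (trans eq (sym eq′)) refl
    keeps′ inj {just _}  {just _}  eq eq′  = cong just (value-injective (inj eq eq′))

    keeps-injective : ∀ {y} → InjectiveAt φ y → InjectiveAt (φ′ ∘ to) y
    keeps-injective inj eq eq′ = to-injective (keeps′ inj eq eq′)

  mergeAll : ∀ {Gs} → HajósConstruction 3 Gs → (M : Mapped R Gs) → ∀ xs →
             After (length xs) Gs λ Hs → Σ (Mapped R Hs) λ N → All (InjectiveAt (position N)) xs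
               × (∀ {y} → InjectiveAt (position M) y → InjectiveAt (position N) y)
  mergeAll con M []       = done con (M , [] , id)
  mergeAll {Gs} con M (x ∷ xs) = weaken (≤-reflexive (+-comm (length xs) 1))
    (bind (merge con M x) λ con′ _ (N , injx , keep) →
      mapAfter (λ (O , injs , keep′) → O , (λ {p} {q} → keep′ injx {p} {q}) ∷ injs , λ inj → keep′ (keep inj)) (mergeAll con′ N xs))

module Joined (G₁ : Digraph) (u₁ v₁ : Vertex G₁) (G₂ : Digraph) (v₂ u₂ : Vertex G₂) (a : Arc G₁ u₁ v₁) where
  open Join G₁ u₁ v₁ G₂ v₂ u₂ using (joined; realisable)
  private module J = Join G₁ u₁ v₁ G₂ v₂ u₂

  graph : Digraph
  graph = proj₁ (realisable a)

  iso : Iso ⟦ graph ⟧ joined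
  iso = proj₂ (realisable a)

  open Iso iso

  left : Vertex G₁ → Vertex graph
  left = from ∘ J.left

  right : Vertex G₂ → Vertex graph
  right = from ∘ J.right

  arc-left : ∀ {x y} → Arc G₁ x y → ¬ (x ≡ u₁ × y ≡ v₁) → Arc graph (left x) (left y)
  arc-left b ¬e = arc← (inj₁ (_ , _ , b , ¬e , refl , refl))

  arc-right : ∀ {x y} → Arc G₂ x y → ¬ (x ≡ v₂ × y ≡ u₂) → Arc graph (right x) (right y)
  arc-right b ¬e = arc← (inj₂ (inj₁ (_ , _ , b , ¬e , refl , refl)))

  arc-elim : (S : Vertex graph → Vertex graph → Set) →
             (∀ {x y} → Arc G₁ x y → ¬ (x ≡ u₁ × y ≡ v₁) → S (left x) (left y)) →
             (∀ {x y} → Arc G₂ x y → ¬ (x ≡ v₂ × y ≡ u₂) → S (right x) (right y)) →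
             S (left u₁) (right u₂) →
             ∀ {p q} → Arc graph p q → S p q
  arc-elim S s₁ s₂ s₃ {p} {q} b = subst₂ S (from∘to p) (from∘to q) (elim (arc→ b))
    where
    elim : ∀ {p q} → Arcʳ joined p q → S (from p) (from q)
    elim (inj₁ (_ , _ , b , ¬e , refl , refl))        = s₁ b ¬e
    elim (inj₂ (inj₁ (_ , _ , b , ¬e , refl , refl))) = s₂ b ¬e
    elim (inj₂ (inj₂ (refl , refl)))                  = s₃

  module _ {X : Set} (f : Vertex G₁ → X) (g : Vertex G₂ → X) (fg : f v₁ ≡ g v₂) where

    copair : Vertex graph → X
    copair = J.copair f g ∘ to

    copair-left : ∀ x → copair (left x) ≡ f x
    copair-left x = trans (cong (J.copair f g) (to∘from _)) (J.copair-left x)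

    copair-right : ∀ x → copair (right x) ≡ g x
    copair-right x = trans (cong (J.copair f g) (to∘from _)) (J.copair-right fg x)

record Clause (R : ℕ → ℕ → Set) (a b c d : ℕ) (Gs : List Digraph) : Set where
  field
    graph           : Digraph
    available       : AvailableFrom 3 Gs graph
    position        : Vertex graph → ℕ
    tail₁ head₁     : Vertex graph
    tail₂ head₂     : Vertex graph
    arc₁            : Arc graph tail₁ head₁
    arc₂            : Arc graph tail₂ head₂
    tail₁-at        : position tail₁ ≡ a
    head₁-at        : position head₁ ≡ b
    tail₂-at        : position tail₂ ≡ c
    head₂-at        : position head₂ ≡ d
    arcs            : ∀ {x y} → Arc graph x y → R (position x) (position y)
                      ⊎ (x ≡ tail₁ × y ≡ head₁) ⊎ (x ≡ tail₂ × y ≡ head₂)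

swapClause : ∀ {R a b c d Gs} → Clause R a b c d Gs → Clause R c d a b Gs
swapClause Γ = record
  { graph = graph ; available = available ; position = position
  ; tail₁ = tail₂ ; head₁ = head₂ ; tail₂ = tail₁ ; head₂ = head₁ ; arc₁ = arc₂ ; arc₂ = arc₁
  ; tail₁-at = tail₂-at ; head₁-at = head₂-at ; tail₂-at = tail₁-at ; head₂-at = head₁-at
  ; arcs = map⊎ id swap⊎ ∘ arcs }
  where open Clause Γ

keepClause : ∀ {R a b c d Gs Hs} → (∀ {G} → AvailableFrom 3 Gs G → AvailableFrom 3 Hs G) →
             Clause R a b c d Gs → Clause R a b c d Hs
keepClause keeps Γ = record
  { graph = graph ; available = keeps available ; position = position
  ; tail₁ = tail₁ ; head₁ = head₁ ; tail₂ = tail₂ ; head₂ = head₂ ; arc₁ = arc₁ ; arc₂ = arc₂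
  ; tail₁-at = tail₁-at ; head₁-at = head₁-at ; tail₂-at = tail₂-at ; head₂-at = head₂-at
  ; arcs = arcs }
  where open Clause Γ

module Resolution (R : ℕ → ℕ → Set) (R-shift : ∀ s {i j} → R i j → R (i + s) (j + s))
                  (R-up : ∀ i → R i (2 + i)) (R-down : ∀ i → R (2 + i) i) where

  shift : ∀ s {a b c d Gs} → Clause R a b c d Gs → Clause R (a + s) (b + s) (c + s) (d + s) Gs
  shift s Γ = record
    { graph = graph ; available = available ; position = (_+ s) ∘ position
    ; tail₁ = tail₁ ; head₁ = head₁ ; tail₂ = tail₂ ; head₂ = head₂ ; arc₁ = arc₁ ; arc₂ = arc₂
    ; tail₁-at = cong (_+ s) tail₁-at ; head₁-at = cong (_+ s) head₁-at
    ; tail₂-at = cong (_+ s) tail₂-at ; head₂-at = cong (_+ s) head₂-at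
    ; arcs = map⊎ (R-shift s) id ∘ arcs }
    where open Clause Γ

  resolve : ∀ {a b u v w c d Gs} → HajósConstruction 3 Gs →
            Clause R a b u v Gs → Clause R v w c d Gs → a ≢ u → c ≢ v → R u w →
            After 1 Gs (Clause R a b c d)
  resolve {a} {b} {u} {v} {w} {c} {d} con Γ Δ a≢u c≢v Ruw = perform con
    (join Γ.graph Δ.graph Γ.available Δ.available Γ.tail₂ Γ.head₂ Γ.arc₂ Δ.tail₁ Δ.head₁ Δ.arc₁ (Iso⇒≅ J.iso))
    λ H∈ → record
      { graph = J.graph ; available = H∈ ; position = position
      ; tail₁ = J.left Γ.tail₁ ; head₁ = J.left Γ.head₁ ; tail₂ = J.right Δ.tail₂ ; head₂ = J.right Δ.head₂
      ; arc₁ = J.arc-left Γ.arc₁ λ (eq , _) → a≢u (trans (sym Γ.tail₁-at) (trans (cong Γ.position eq) Γ.tail₂-at))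
      ; arc₂ = J.arc-right Δ.arc₂ λ (eq , _) → c≢v (trans (sym Δ.tail₂-at) (trans (cong Δ.position eq) Δ.tail₁-at))
      ; tail₁-at = trans (at-left _) Γ.tail₁-at ; head₁-at = trans (at-left _) Γ.head₁-at
      ; tail₂-at = trans (at-right _) Δ.tail₂-at ; head₂-at = trans (at-right _) Δ.head₂-at
      ; arcs = J.arc-elim Allowed arcs₁ arcs₂
          (inj₁ (subst₂ R (sym (trans (at-left _) Γ.tail₂-at)) (sym (trans (at-right _) Δ.head₁-at)) Ruw))
      }
    where
    module Γ = Clause Γ
    module Δ = Clause Δ
    module J = Joined Γ.graph Γ.tail₂ Γ.head₂ Δ.graph Δ.tail₁ Δ.head₁ Γ.arc₂

    glued : Γ.position Γ.head₂ ≡ Δ.position Δ.tail₁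
    glued = trans Γ.head₂-at (sym Δ.tail₁-at)

    position : Vertex J.graph → ℕ
    position = J.copair Γ.position Δ.position glued

    at-left : ∀ x → position (J.left x) ≡ Γ.position x
    at-left = J.copair-left Γ.position Δ.position glued

    at-right : ∀ x → position (J.right x) ≡ Δ.position x
    at-right = J.copair-right Γ.position Δ.position glued

    Allowed : Vertex J.graph → Vertex J.graph → Set
    Allowed p q = R (position p) (position q)
      ⊎ (p ≡ J.left Γ.tail₁ × q ≡ J.left Γ.head₁) ⊎ (p ≡ J.right Δ.tail₂ × q ≡ J.right Δ.head₂)

    arcs₁ : ∀ {x y} → Arc Γ.graph x y → ¬ (x ≡ Γ.tail₂ × y ≡ Γ.head₂) → Allowed (J.left x) (J.left y)
    arcs₁ b ¬e with Γ.arcs b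
    ... | inj₁ r                    = inj₁ (subst₂ R (sym (at-left _)) (sym (at-left _)) r)
    ... | inj₂ (inj₁ (refl , refl)) = inj₂ (inj₁ (refl , refl))
    ... | inj₂ (inj₂ e)             = contradiction e ¬e

    arcs₂ : ∀ {x y} → Arc Δ.graph x y → ¬ (x ≡ Δ.tail₁ × y ≡ Δ.head₁) → Allowed (J.right x) (J.right y)
    arcs₂ b ¬e with Δ.arcs b
    ... | inj₁ r                    = inj₁ (subst₂ R (sym (at-right _)) (sym (at-right _)) r)
    ... | inj₂ (inj₁ e)             = contradiction e ¬e
    ... | inj₂ (inj₂ (refl , refl)) = inj₂ (inj₂ (refl , refl))

  consecutive : ∀ {Gs} → HajósConstruction 3 Gs → Clause R 0 1 1 0 Gs → After 1 Gs (Clause R 0 1 1 2)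
  consecutive con Γ = mapAfter swapClause
    (resolve con (shift 1 Γ) (swapClause Γ) (λ ()) (λ ()) (R-down 0))

  chain : ∀ k {Gs} → HajósConstruction 3 Gs → Clause R 0 1 1 2 Gs →
          After k Gs (Clause R 0 1 (1 + k * 2) (2 + k * 2))
  chain zero    con Γ = done con Γ
  chain (suc k) con Γ = bind (chain k con Γ) λ con′ keeps Δ →
    resolve con′ Δ (shift (2 + k * 2) (keepClause keeps Γ)) (λ ()) 1+n≢n (R-up (1 + k * 2))

-- Cycles

cyclicSuc-unique : ∀ {k} {i j j′ : Fin k} → CyclicSuc i j → CyclicSuc i j′ → j ≡ j′
cyclicSuc-unique (inj₁ p)       (inj₁ q)       = toℕ-injective (trans p (sym q))
cyclicSuc-unique (inj₂ (_ , p)) (inj₂ (_ , q)) = toℕ-injective (trans p (sym q))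
cyclicSuc-unique {j = j} (inj₁ p) (inj₂ (q , _)) = contradiction (toℕ<n j) (<-irrefl (trans p q))
cyclicSuc-unique {j′ = j} (inj₂ (q , _)) (inj₁ p) = contradiction (toℕ<n j) (<-irrefl (trans p q))

next : ∀ {k} (i : Fin k) → ∃ (CyclicSuc i)
next {suc k} i with m≤n⇒m<n∨m≡n (toℕ<n i)
... | inj₁ lt = fromℕ< lt , inj₁ (toℕ-fromℕ< lt)
... | inj₂ eq = zero , inj₂ (eq , refl)

cyclicSuc-irreflexive : ∀ {k} {i : Fin (2 + k)} → ¬ CyclicSuc i i
cyclicSuc-irreflexive (inj₁ p)       = 1+n≢n (sym p)
cyclicSuc-irreflexive (inj₂ (p , q)) = 0≢1+n (suc-injective (trans (sym (cong suc q)) p))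

cycle-arc⁻ : ∀ {k} {i j : Fin k} → Arc (D (C k)) i j → CyclicSuc i j ⊎ CyclicSuc j i
cycle-arc⁻ a = proj₂ (toWitness a)

cycle-arc⁺ : ∀ {k} {i j : Fin (2 + k)} → CyclicSuc i j ⊎ CyclicSuc j i → Arc (D (C (2 + k))) i j
cycle-arc⁺ s = fromWitness ((λ { refl → irreflexive s }) , s)
  where
  irreflexive : ∀ {k} {i : Fin (2 + k)} → ¬ (CyclicSuc i i ⊎ CyclicSuc i i)
  irreflexive (inj₁ p) = cyclicSuc-irreflexive p
  irreflexive (inj₂ p) = cyclicSuc-irreflexive p

odd : ℕ → Bool
odd zero    = false
odd (suc n) = not (odd n)

odd-double : ∀ m → odd (m * 2) ≡ false
odd-double zero    = refl
odd-double (suc m) = trans (not-involutive _) (odd-double m)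

-- Proper along the cycle except between position s and its successor.
cutColour : ℕ → ℕ → Bool
cutColour s i with i ≤? s
... | yes _ = odd i
... | no _  = not (odd i)

module _ {m : ℕ} where
  private
    N : ℕ
    N = suc (m * 2)

  cutColour-proper : ∀ {s i j : Fin N} → CyclicSuc i j →
                     cutColour (toℕ s) (toℕ i) ≡ cutColour (toℕ s) (toℕ j) → i ≡ s
  cutColour-proper {s} {i} {j} (inj₁ p) eq rewrite p with toℕ i ≤? toℕ s | suc (toℕ i) ≤? toℕ s
  ... | yes _   | yes _   = contradiction eq (not-¬ refl)
  ... | yes i≤s | no i≮s  = toℕ-injective (≤-antisym i≤s (≮⇒≥ i≮s))
  ... | no i≰s  | yes i<s = contradiction (<⇒≤ i<s) i≰s
  ... | no _    | no _    = contradiction eq (not-¬ refl)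
  cutColour-proper {s} {i} {j} (inj₂ (p , q)) eq rewrite q | suc-injective p with m * 2 ≤? toℕ s
  ... | yes i≤s = toℕ-injective (trans (suc-injective p) (≤-antisym i≤s (s≤s⁻¹ (toℕ<n s))))
  ... | no _ rewrite odd-double m = contradiction eq λ ()

  cut-edge : ∀ {s t i j : Fin N} → CyclicSuc s t → Arc (D (C N)) i j →
             cutColour (toℕ s) (toℕ i) ≡ cutColour (toℕ s) (toℕ j) →
             (i ≡ s × j ≡ t) ⊎ (i ≡ t × j ≡ s)
  cut-edge {s} {t} {i} {j} st a eq with cycle-arc⁻ a
  ... | inj₁ ij = let i≡s = cutColour-proper {s} {i} {j} ij eq in
    inj₁ (i≡s , cyclicSuc-unique (subst (λ k → CyclicSuc k j) i≡s ij) st)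
  ... | inj₂ ji = let j≡s = cutColour-proper {s} {j} {i} ji (sym eq) in
    inj₂ (cyclicSuc-unique (subst (λ k → CyclicSuc k i) j≡s ji) st , j≡s)

  missing-arc⇒colourable : ∀ {G} (φ : Vertex G → Fin N) → (∀ {x y} → Arc G x y → Arc (D (C N)) (φ x) (φ y)) →
                           ∀ {a b} → Arc (D (C N)) a b → (∀ {x y} → Arc G x y → ¬ (φ x ≡ a × φ y ≡ b)) →
                           Colourable ⟦ G ⟧
  missing-arc⇒colourable {G} φ hom {a} {b} ab missing =
    cutColour (toℕ (cutAt (cycle-arc⁻ ab))) ∘ toℕ ∘ φ , rank , increasing
    where
    cutAt : CyclicSuc a b ⊎ CyclicSuc b a → Fin N
    cutAt (inj₁ _) = a
    cutAt (inj₂ _) = b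

    cut : ∀ s {i j} → Arc (D (C N)) i j →
          cutColour (toℕ (cutAt s)) (toℕ i) ≡ cutColour (toℕ (cutAt s)) (toℕ j) →
          (i ≡ a × j ≡ b) ⊎ (i ≡ b × j ≡ a)
    cut (inj₁ ab) arc eq = cut-edge ab arc eq
    cut (inj₂ ba) arc eq = swap⊎ (cut-edge ba arc eq)

    rank : Vertex G → ℕ
    rank x = if does (φ x ≟ b) then 0 else 1

    increasing : ∀ {x y} → Arc G x y →
                 cutColour (toℕ (cutAt (cycle-arc⁻ ab))) (toℕ (φ x)) ≡ cutColour (toℕ (cutAt (cycle-arc⁻ ab))) (toℕ (φ y)) →
                 rank x < rank y
    increasing {x} {y} arc eq with cut (cycle-arc⁻ ab) (hom arc) eq
    ... | inj₁ e = contradiction e (missing arc)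
    ... | inj₂ (φx≡b , φy≡a) with φ x ≟ b | φ y ≟ b
    ... | no φx≢b | _        = contradiction φx≡b φx≢b
    ... | yes _   | yes φy≡b = contradiction (subst₂ (Arc (D (C N))) (trans (sym φy≡a) φy≡b) refl ab) (Digraph.loopless (D (C N)) b)
    ... | yes _   | no _     = s≤s z≤n

CycleAvailable : ℕ → List Digraph → Set
CycleAvailable k Gs = ∃ λ G → AvailableFrom 3 Gs G × Iso ⟦ D (C k) ⟧ ⟦ G ⟧

module _ {m′ : ℕ} where
  private
    m N : ℕ
    m = suc m′
    N = suc (m * 2)

  embedding⇒iso : ∀ {G} → ¬ Colourable ⟦ G ⟧ → (φ : Vertex G → Fin N) →
                  (∀ {x y} → Arc G x y → Arc (D (C N)) (φ x) (φ y)) →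
                  (∀ i → InjectiveAt φ i) → Iso ⟦ D (C N) ⟧ ⟦ G ⟧
  embedding⇒iso {G} uncolourable φ hom injective = record
    { to      = vertex
    ; from    = φ
    ; to∘from = λ x → injective _ (vertex-over (φ x)) refl
    ; from∘to = vertex-over
    ; arc→    = arc-between
    ; arc←    = hom
    }
    where
    lift-arc : ∀ {a b} → Arc (D (C N)) a b → ∃₂ λ x y → Arc G x y × φ x ≡ a × φ y ≡ b
    lift-arc {a} {b} ab with any? (λ x → any? λ y → T? (Digraph.arc G x y) ×-dec φ x ≟ a ×-dec φ y ≟ b)
    ... | yes lifted = lifted
    ... | no missing = contradiction
      (missing-arc⇒colourable {m} {G} φ hom ab λ {x} {y} arc e → missing (x , y , arc , e)) uncolourable

    out-arc : ∀ i → Arc (D (C N)) i (proj₁ (next i))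
    out-arc i = cycle-arc⁺ (inj₁ (proj₂ (next i)))

    vertex : Fin N → Vertex G
    vertex i = proj₁ (lift-arc (out-arc i))

    vertex-over : ∀ i → φ (vertex i) ≡ i
    vertex-over i = let _ , _ , _ , eq , _ = lift-arc (out-arc i) in eq

    arc-between : ∀ {a b} → Arc (D (C N)) a b → Arc G (vertex a) (vertex b)
    arc-between {a} {b} ab = let x , y , arc , φx≡a , φy≡b = lift-arc ab in
      subst₂ (Arc G) (injective a φx≡a (vertex-over a)) (injective b φy≡b (vertex-over b)) arc

  mergeToCycle : ∀ {Gs} → HajósConstruction 3 Gs → Mapped (Arc (D (C N))) Gs → After N Gs (CycleAvailable N)
  mergeToCycle {Gs} con M = subst (λ k → After k Gs (CycleAvailable N)) (length-tabulate {n = N} id)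
    (recognise (mergeAll _≟_ (Digraph.loopless (D (C N)) _) con M (allFin N)))
    where
    recognise : ∀ {k} → After k Gs (λ Hs → Σ (Mapped (Arc (D (C N))) Hs) λ M′ →
                  All (InjectiveAt (Mapped.position M′)) (allFin N)
                  × (∀ {y} → InjectiveAt (Mapped.position M) y → InjectiveAt (Mapped.position M′) y)) →
                After k Gs (CycleAvailable N)
    recognise (after con′ cost keeps (M′ , inj , _)) = after con′ cost keeps
      (graph , available , embedding⇒iso {graph} (available-uncolourable con′ available) position arcs
        λ i → All.lookup inj (∈-allFin i))
      where open Mapped M′

-- Doubling

module Doubling (d′ : ℕ) where
  private
    d N : ℕ
    d = suc d′
    N = suc (d * 2)

  infix 4 _≈_
  record _≈_ (i j : ℕ) : Set where
    constructor mod
    field remainders : i % N ≡ j % N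

  open _≈_

  ≈-sym : ∀ {i j} → i ≈ j → j ≈ i
  ≈-sym (mod p) = mod (sym p)

  ≈-trans : ∀ {i j k} → i ≈ j → j ≈ k → i ≈ k
  ≈-trans (mod p) (mod q) = mod (trans p q)

  ≈-+ : ∀ s {i j} → i ≈ j → (i + s) ≈ (j + s)
  ≈-+ s {i} {j} (mod eq) = mod (trans (%-distribˡ-+ i s N)
    (trans (cong (λ k → (k + s % N) % N) eq) (sym (%-distribˡ-+ j s N))))

  ≈-* : ∀ s {i j} → i ≈ j → (i * s) ≈ (j * s)
  ≈-* s {i} {j} (mod eq) = mod (trans (%-distribˡ-* i s N)
    (trans (cong (λ k → (k * (s % N)) % N) eq) (sym (%-distribˡ-* j s N))))

  ≈-suc : ∀ {i j} → i ≈ j → suc i ≈ suc j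
  ≈-suc {i} {j} eq = subst₂ _≈_ (+-comm i 1) (+-comm j 1) (≈-+ 1 eq)

  %-≈ : ∀ i → i % N ≈ i
  %-≈ i = mod (m%n%n≡m%n i N)

  +N-≈ : ∀ i → i + N ≈ i
  +N-≈ i = mod ([m+n]%n≡m%n i N)

  Step : ℕ → ℕ → Set
  Step i j = 2 + i ≈ j

  Adjacent : ℕ → ℕ → Set
  Adjacent i j = Step i j ⊎ Step j i

  adjacent-shift : ∀ s {i j} → Adjacent i j → Adjacent (i + s) (j + s)
  adjacent-shift s = map⊎ (≈-+ s) (≈-+ s)

  adjacent-≈ : ∀ {i i′ j j′} → i ≈ i′ → j ≈ j′ → Adjacent i j → Adjacent i′ j′
  adjacent-≈ p q = map⊎ (λ s → ≈-trans (≈-suc (≈-suc (≈-sym p))) (≈-trans s q))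
                        (λ s → ≈-trans (≈-suc (≈-suc (≈-sym q))) (≈-trans s p))

  -- Multiplication by d + 1, the inverse of 2 modulo N, turns steps of 2 into steps of 1.
  vertexAt : ℕ → Fin N
  vertexAt i = fromℕ< (m%n<n (i * suc d) N)

  step-cyclicSuc : ∀ {i j} → Step i j → CyclicSuc (vertexAt i) (vertexAt j)
  step-cyclicSuc {i} {j} step
    rewrite toℕ-fromℕ< (m%n<n (i * suc d) N) | toℕ-fromℕ< (m%n<n (j * suc d) N)
    = successor (m≤n⇒m<n∨m≡n (m%n<n (i * suc d) N))
    where
    x : ℕ
    x = (i * suc d) % N

    double-half : ∀ i d → suc (i * suc d) + suc (d * 2) ≡ (2 + i) * suc d
    double-half = solve-∀

    j≡ : (j * suc d) % N ≡ suc x % N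
    j≡ = sym (remainders (≈-trans (≈-suc (%-≈ (i * suc d)))
      (≈-trans (≈-sym (+N-≈ (suc (i * suc d))))
      (subst (_≈ (j * suc d)) (sym (double-half i d)) (≈-* (suc d) step)))))

    successor : suc x < N ⊎ suc x ≡ N →
                (j * suc d) % N ≡ suc x ⊎ (suc x ≡ N × (j * suc d) % N ≡ 0)
    successor (inj₁ lt) = inj₁ (trans j≡ (m<n⇒m%n≡m lt))
    successor (inj₂ eq) = inj₂ (eq , trans j≡ (trans (cong (_% N) eq) (n%n≡0 N)))

  adjacent-arc : ∀ {i j} → Adjacent i j → Arc (D (C N)) (vertexAt i) (vertexAt j)
  adjacent-arc = cycle-arc⁺ ∘ map⊎ step-cyclicSuc step-cyclicSuc

  adjacent-irreflexive : ∀ {i} → ¬ Adjacent i i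
  adjacent-irreflexive a = Digraph.loopless (D (C N)) _ (adjacent-arc a)

  open Resolution Adjacent adjacent-shift (λ _ → inj₁ (mod refl)) (λ _ → inj₂ (mod refl))

  -- The path from vertex 1 through vertex d to vertex 0 runs in steps of 2
  -- from 1 to N ≈ 0, leaving only the arcs between vertices 0 and 1.
  unroll : Fin (suc d) → ℕ
  unroll zero    = 0
  unroll (suc i) = 1 + toℕ i * 2

  unroll-step : ∀ {i j} → CyclicSuc i j → Step (unroll i) (unroll j) ⊎ (i ≡ zero × j ≡ suc zero)
  unroll-step {zero}  {suc zero} (inj₁ p)       = inj₂ (refl , refl)
  unroll-step {suc i} {suc j}    (inj₁ p)       =
    inj₁ (mod (cong (λ k → (1 + k * 2) % N) (sym (suc-injective p))))
  unroll-step {suc i} {zero}     (inj₂ (p , _)) =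
    inj₁ (mod (trans (cong (λ k → (1 + k * 2) % N) (suc-injective p)) (n%n≡0 N)))
  unroll-step {suc i} {suc j}    (inj₂ (_ , ()))

  unrolled : ∀ {Gs} → CycleAvailable (suc d) Gs → Clause Adjacent 0 1 1 0 Gs
  unrolled (G , G∈ , i) = record
    { graph = G ; available = G∈ ; position = unroll ∘ from
    ; tail₁ = to zero ; head₁ = to (suc zero) ; tail₂ = to (suc zero) ; head₂ = to zero
    ; arc₁ = arc→ {zero} {suc zero} _
    ; arc₂ = arc→ {suc zero} {zero} (cycle-arc⁺ {i = suc zero} {zero} (inj₂ (inj₁ refl)))
    ; tail₁-at = cong unroll (from∘to _) ; head₁-at = cong unroll (from∘to _)
    ; tail₂-at = cong unroll (from∘to _) ; head₂-at = cong unroll (from∘to _)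
    ; arcs = λ a → classify (cycle-arc⁻ (arc← a))
    }
    where
    open Iso i

    to-eq : ∀ {x k} → from x ≡ k → x ≡ to k
    to-eq eq = trans (sym (to∘from _)) (cong to eq)

    classify : ∀ {x y} → CyclicSuc (from x) (from y) ⊎ CyclicSuc (from y) (from x) →
               Adjacent (unroll (from x)) (unroll (from y))
               ⊎ (x ≡ to zero × y ≡ to (suc zero)) ⊎ (x ≡ to (suc zero) × y ≡ to zero)
    classify (inj₁ s) with unroll-step s
    ... | inj₁ step      = inj₁ (inj₁ step)
    ... | inj₂ (p , q)   = inj₂ (inj₁ (to-eq p , to-eq q))
    classify (inj₂ s) with unroll-step s
    ... | inj₁ step      = inj₁ (inj₂ step)
    ... | inj₂ (p , q)   = inj₂ (inj₂ (to-eq q , to-eq p))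

  Adjacent⁺ : ℕ → ℕ → Set
  Adjacent⁺ i j = Adjacent i j ⊎ (i ≡ 0 × j ≡ 1)

  adjacent⁺-irreflexive : ∀ {i} → ¬ Adjacent⁺ i i
  adjacent⁺-irreflexive (inj₁ a)             = adjacent-irreflexive a
  adjacent⁺-irreflexive (inj₂ (refl , ()))

  wrapped : ∀ {Gs} → Clause Adjacent 0 1 (1 + d * 2) (2 + d * 2) Gs → Mapped Adjacent⁺ Gs
  wrapped Γ = record
    { graph = graph ; available = available ; position = (_% N) ∘ position ; arcs = λ a → wrap (arcs a) }
    where
    open Clause Γ

    wrap : ∀ {x y} → Adjacent (position x) (position y)
                     ⊎ (x ≡ tail₁ × y ≡ head₁) ⊎ (x ≡ tail₂ × y ≡ head₂) →
           Adjacent⁺ (position x % N) (position y % N)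
    wrap (inj₁ a)                    = inj₁ (adjacent-≈ (≈-sym (%-≈ _)) (≈-sym (%-≈ _)) a)
    wrap (inj₂ (inj₁ (refl , refl))) = inj₂ (cong (_% N) tail₁-at , cong (_% N) head₁-at)
    wrap (inj₂ (inj₂ (refl , refl))) = inj₂ (trans (cong (_% N) tail₂-at) (n%n≡0 N) ,
                                             trans (cong (_% N) head₂-at) ([m+n]%n≡m%n 1 N))

  closeUp : ∀ {Gs} → HajósConstruction 3 Gs → (M : Mapped Adjacent⁺ Gs) →
            InjectiveAt (Mapped.position M) 0 → InjectiveAt (Mapped.position M) 1 →
            After 1 Gs (Mapped (Arc (D (C N))))
  closeUp con M inj₀ inj₁′ with any? (λ x → any? λ y →
      T? (Digraph.arc (Mapped.graph M) x y) ×-dec Mapped.position M x ≟ℕ 0 ×-dec Mapped.position M y ≟ℕ 1)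
  ... | no none = done con record
      { graph = graph ; available = available ; position = vertexAt ∘ position ; arcs = λ a → proper a (arcs a) }
    where
    open Mapped M

    proper : ∀ {x y} → Arc graph x y → Adjacent⁺ (position x) (position y) →
             Arc (D (C N)) (vertexAt (position x)) (vertexAt (position y))
    proper a (inj₁ adj) = adjacent-arc adj
    proper a (inj₂ e)   = contradiction (_ , _ , a , e) none
  ... | yes (u , v , uv , u-at , v-at) = perform con
      (join graph graph available available u v uv u v uv (Iso⇒≅ J.iso))
      λ H∈ → record
        { graph = J.graph ; available = H∈ ; position = vertexAt ∘ position′
        ; arcs = λ a → adjacent-arc (J.arc-elim (λ p q → Adjacent (position′ p) (position′ q))
            (λ {x} {y} b ¬e → subst₂ Adjacent (sym (at-left x)) (sym (at-left y)) (other ¬e (arcs b)))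
            (λ {x} {y} b ¬e → subst₂ Adjacent (sym (at-right x)) (sym (at-right y))
              (adjacent-shift 1 (other ¬e (arcs b))))
            (subst₂ Adjacent (sym (trans (at-left u) u-at))
              (sym (trans (at-right v) (cong (_+ 1) v-at))) (inj₁ (mod refl)))
            a) }
    where
    open Mapped M
    module J = Joined graph u v graph u v uv

    glued : position v ≡ position u + 1
    glued = trans v-at (cong (_+ 1) (sym u-at))

    position′ : Vertex J.graph → ℕ
    position′ = J.copair position ((_+ 1) ∘ position) glued

    at-left : ∀ x → position′ (J.left x) ≡ position x
    at-left = J.copair-left position ((_+ 1) ∘ position) glued

    at-right : ∀ x → position′ (J.right x) ≡ position x + 1
    at-right = J.copair-right position ((_+ 1) ∘ position) glued

    other : ∀ {x y} → ¬ (x ≡ u × y ≡ v) → Adjacent⁺ (position x) (position y) → Adjacent (position x) (position y)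
    other ¬e (inj₁ adj)         = adj
    other ¬e (inj₂ (x-at , y-at)) = contradiction (inj₀ x-at u-at , inj₁′ y-at v-at) ¬e

  InjectiveMapped : List ℕ → List Digraph → Set
  InjectiveMapped is Gs = Σ (Mapped Adjacent⁺ Gs) λ M → All (InjectiveAt (Mapped.position M)) is

  mergeEnds : ∀ {Gs} → HajósConstruction 3 Gs → Mapped Adjacent⁺ Gs →
              After 2 Gs (InjectiveMapped (0 ∷ 1 ∷ []))
  mergeEnds con M = mapAfter (λ (M′ , injective , _) → M′ , injective)
    (mergeAll _≟ℕ_ adjacent⁺-irreflexive con M (0 ∷ 1 ∷ []))

  double : ∀ {Gs} → HajósConstruction 3 Gs → CycleAvailable (suc d) Gs →
           After (N + (1 + (2 + (d + 1)))) Gs (CycleAvailable N)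
  double con cycle = bind {l = N} (bind (bind (bind
    (consecutive con (unrolled cycle))
    λ con₁ _ Γ → chain d con₁ Γ)
    λ con₂ _ Γ → mergeEnds con₂ (wrapped Γ))
    λ { con₃ _ (M , inj₀ ∷ inj₁′ ∷ []) → closeUp con₃ M inj₀ inj₁′ })
    λ con₄ _ M → mergeToCycle {d′} con₄ M

-- The dichromatic number

module _ {m′ : ℕ} where
  private
    m N : ℕ
    m = suc m′
    N = suc (m * 2)

  bit : Bool → Fin 3
  bit false = zero
  bit true  = suc zero

  bit-injective : ∀ {b c} → bit b ≡ bit c → b ≡ c
  bit-injective {false} {false} _ = refl
  bit-injective {true}  {true}  _ = refl

  bit≢2 : ∀ {b} → bit b ≢ suc (suc zero)
  bit≢2 {false} ()
  bit≢2 {true}  ()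

  threeColour : ℕ → Fin 3
  threeColour i with i ≟ℕ m * 2
  ... | yes _ = suc (suc zero)
  ... | no _  = bit (odd i)

  threeColour-proper : ∀ {i j : Fin N} → CyclicSuc i j → threeColour (toℕ i) ≢ threeColour (toℕ j)
  threeColour-proper {i} {j} (inj₁ p) rewrite p with toℕ i ≟ℕ m * 2 | suc (toℕ i) ≟ℕ m * 2
  ... | yes q | _     = λ _ → <-irrefl (trans p (cong suc q)) (toℕ<n j)
  ... | no _  | yes _ = bit≢2
  ... | no _  | no _  = not-¬ refl ∘ bit-injective
  threeColour-proper {i} {j} (inj₂ (p , q)) rewrite q | suc-injective p with m * 2 ≟ℕ m * 2
  ... | yes _ = bit≢2 {false} ∘ sym
  ... | no ¬r = contradiction refl ¬r

  dicolourable₃ : Dicolourable (D (C N)) 3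
  dicolourable₃ = threeColour ∘ toℕ , λ Z → acyclic Z (DirectedCycle.nonempty Z)
    where
    acyclic : (Z : DirectedCycle (D (C N))) → 1 ≤ DirectedCycle.len Z → ¬ Monochromatic {D (C N)} (threeColour ∘ toℕ) Z
    acyclic Z 1≤len mono with next (fromℕ< 1≤len)
    ... | j , succ with cycle-arc⁻ (DirectedCycle.arcs Z _ j succ)
    ... | inj₁ s = threeColour-proper s (mono _ _)
    ... | inj₂ s = threeColour-proper s (mono _ _)

digon : ∀ {G i j} → Arc G i j → Arc G j i → DirectedCycle G
digon {G} {i} {j} ij ji = record
  { len = 2 ; nonempty = s≤s z≤n ; vertex = vertex
  ; injective = injective _ _ ; arcs = arcs }
  where
  i≢j : i ≢ j
  i≢j eq = Digraph.loopless G j (subst (λ k → Arc G k j) eq ij)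

  vertex : Fin 2 → Vertex G
  vertex zero    = i
  vertex (suc _) = j

  injective : ∀ a b → vertex a ≡ vertex b → a ≡ b
  injective zero       zero       _  = refl
  injective zero       (suc zero) eq = contradiction eq i≢j
  injective (suc zero) zero       eq = contradiction (sym eq) i≢j
  injective (suc zero) (suc zero) _  = refl

  arcs : ∀ a b → CyclicSuc a b → Arc G (vertex a) (vertex b)
  arcs zero       (suc zero) _               = ij
  arcs (suc zero) zero       _               = ji
  arcs zero       zero       (inj₁ ())
  arcs zero       zero       (inj₂ (() , _))
  arcs (suc zero) (suc zero) (inj₁ ())
  arcs (suc zero) (suc zero) (inj₂ (_ , ()))

isZero : ∀ {l} → Fin l → Bool
isZero zero    = true
isZero (suc _) = false

isZero-injective : ∀ {l} → l ≤ 2 → {i j : Fin l} → isZero i ≡ isZero j → i ≡ j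
isZero-injective l≤2 {zero}  {zero}  _ = refl
isZero-injective (s≤s (s≤s z≤n)) {suc zero} {suc zero} _ = refl

symmetric-dicolourable⇒colourable : ∀ {G l} → (∀ {u v} → Arc G u v → Arc G v u) → l ≤ 2 →
                                    Dicolourable G l → Colourable ⟦ G ⟧
symmetric-dicolourable⇒colourable {G} {l} symm l≤2 (c , acyclic) = isZero ∘ c , (λ _ → 0) , λ a eq →
  contradiction (monochromatic a (isZero-injective l≤2 eq)) (acyclic (digon {G} a (symm a)))
  where
  monochromatic : ∀ {u v} (a : Arc G u v) → c u ≡ c v → Monochromatic {G} c (digon {G} a (symm a))
  monochromatic a eq zero    zero    = refl
  monochromatic a eq zero    (suc _) = eq
  monochromatic a eq (suc _) zero    = sym eq
  monochromatic a eq (suc _) (suc _) = refl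

hajósNumber≤ : ∀ {k N} m → 0 < m → suc (m * 2) ≡ N → After k [] (CycleAvailable (suc (m * 2))) →
               ∃ λ h → IsHajósNumber (D (C N)) h × h ≤ k
hajósNumber≤ {k} (suc m) _ refl (after {Gs} con cost _ (G , G∈ , i)) =
  let h , isMinimum , h≤ = minimum (Search.obtainable? 3 (D (C N))) (length Gs) (Gs , con , refl , G , G∈ , Iso⇒≅ i)
  in h , (3 , (dicolourable₃ {m} , λ l dicolouring → ≮⇒≥ λ l<3 → uncolourable
        (symmetric-dicolourable⇒colourable {D (C N)} (λ {u} {v} → Graph.symmetric (C N) u v) (≤-pred l<3) dicolouring))
      , isMinimum) , ≤-trans h≤ (≤-trans cost (≤-reflexive (+-identityʳ k)))
  where
  N : ℕ
  N = suc (suc m * 2)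

  uncolourable : ¬ Colourable ⟦ D (C N) ⟧
  uncolourable = available-uncolourable con G∈ ∘ colourable-pullback {⟦ G ⟧} {⟦ D (C N) ⟧} (Iso.from i) (Iso.arc← i)

-- Folding long odd cycles

module Folding (m′ l : ℕ) (m≤l : suc m′ ≤ l) where
  private
    m N M : ℕ
    m = suc m′
    N = suc (l * 2)
    M = suc (m * 2)

  fold : ℕ → ℕ
  fold i with i ≤? m * 2
  ... | yes _ = i
  ... | no _  = if odd i then 0 else m * 2

  fold< : ∀ i → fold i < M
  fold< i with i ≤? m * 2
  ... | yes i≤ = s≤s i≤
  ... | no _ with odd i
  ... | true  = s≤s z≤n
  ... | false = ≤-refl

  fold-low : ∀ {i} → i ≤ m * 2 → fold i ≡ i
  fold-low {i} i≤ with i ≤? m * 2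
  ... | yes _ = refl
  ... | no i≰ = contradiction i≤ i≰

  fold-high : ∀ {i} → m * 2 ≤ i → fold i ≡ (if odd i then 0 else m * 2)
  fold-high {i} ≤i with i ≤? m * 2
  ... | no _ = refl
  ... | yes i≤ rewrite ≤-antisym i≤ ≤i | odd-double m = refl

  Successor : ℕ → ℕ → Set
  Successor a b = b ≡ suc a ⊎ (suc a ≡ M × b ≡ 0)

  fold-suc : ∀ i → Successor (fold i) (fold (suc i)) ⊎ Successor (fold (suc i)) (fold i)
  fold-suc i = step (suc i ≤? m * 2)
    where
    step : Dec (i < m * 2) → Successor (fold i) (fold (suc i)) ⊎ Successor (fold (suc i)) (fold i)
    step (yes i<) = inj₁ (inj₁ (trans (fold-low i<) (cong suc (sym (fold-low (<⇒≤ i<))))))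
    step (no i≮) rewrite fold-high (≮⇒≥ i≮) | fold-high (m≤n⇒m≤1+n (≮⇒≥ i≮)) with odd i
    ... | true  = inj₂ (inj₂ (refl , refl))
    ... | false = inj₁ (inj₂ (refl , refl))

  fold-last : Successor (fold (l * 2)) (fold 0)
  fold-last rewrite fold-high (*-monoˡ-≤ 2 m≤l) | odd-double l = inj₂ (refl , refl)

  foldVertex : Fin N → Fin M
  foldVertex i = fromℕ< (fold< (toℕ i))

  foldVertex-step : ∀ {i j} → CyclicSuc i j →
                    CyclicSuc (foldVertex i) (foldVertex j) ⊎ CyclicSuc (foldVertex j) (foldVertex i)
  foldVertex-step {i} {j} s
    rewrite toℕ-fromℕ< (fold< (toℕ i)) | toℕ-fromℕ< (fold< (toℕ j)) = step s
    where
    step : CyclicSuc i j → Successor (fold (toℕ i)) (fold (toℕ j)) ⊎ Successor (fold (toℕ j)) (fold (toℕ i))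
    step (inj₁ p) rewrite p = fold-suc (toℕ i)
    step (inj₂ (p , q)) rewrite q | suc-injective p = inj₁ fold-last

  folded : ∀ {Gs} → CycleAvailable N Gs → Mapped (Arc (D (C M))) Gs
  folded (G , G∈ , i) = record
    { graph = G ; available = G∈ ; position = foldVertex ∘ from ; arcs = λ a → fold-arc (cycle-arc⁻ (arc← a)) }
    where
    open Iso i

    fold-arc : ∀ {x y} → CyclicSuc x y ⊎ CyclicSuc y x → Arc (D (C M)) (foldVertex x) (foldVertex y)
    fold-arc (inj₁ s) = cycle-arc⁺ (foldVertex-step s)
    fold-arc (inj₂ s) = cycle-arc⁺ (swap⊎ (foldVertex-step s))

-- Counting operations

cost : ℕ → ℕ
cost zero    = 0
cost (suc n) = let d = 2 ^ suc n in (suc (d * 2) + (1 + (2 + (d + 1)))) + cost n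

double : ∀ {d Gs} → 0 < d → HajósConstruction 3 Gs → CycleAvailable (suc d) Gs →
         After (suc (d * 2) + (1 + (2 + (d + 1)))) Gs (CycleAvailable (suc (d * 2)))
double {suc d} _ = Doubling.double d

triangle : ∀ {Gs} → CycleAvailable 3 Gs
triangle = D (K 3) , inj₁ refl , from-yes (iso? (D (C 3)) (D (K 3)))

powerCycle : ∀ n → After (cost n) [] (CycleAvailable (suc (2 ^ suc n)))
powerCycle zero    = done [] triangle
powerCycle (suc n) = bind (powerCycle n) λ con _ cycle →
  mapAfter (λ {Hs} → subst (λ k → CycleAvailable (suc k) Hs) (*-comm (2 ^ suc n) 2))
    (double (m^n>0 2 (suc n)) con cycle)

shorterCycle : ∀ {m l Gs} → 0 < m → m ≤ l → HajósConstruction 3 Gs → CycleAvailable (suc (l * 2)) Gs →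
               After (suc (m * 2)) Gs (CycleAvailable (suc (m * 2)))
shorterCycle {suc m} {l} _ m≤l con cycle = mergeToCycle {m} con (Folding.folded m l m≤l cycle)

budget : ℕ → ℕ
budget n = n * (2 ^ (n + 2) + n + 5)

cost-bound : ∀ n → (cost n + 2 ^ suc n + 5) * 2 ≤ suc n * (4 * 2 ^ suc n + suc n + 5)
cost-bound zero    = ≤-refl
cost-bound (suc n) = step (cost n) n (m^n>0 2 (suc n)) (cost-bound n)
  where

  step : ∀ {p} c n → 0 < p → (c + p + 5) * 2 ≤ suc n * (4 * p + suc n + 5) →
         (((suc (p * 2) + (1 + (2 + (p + 1)))) + c) + 2 * p + 5) * 2
         ≤ suc (suc n) * (4 * (2 * p) + suc (suc n) + 5)
  step {suc q} c n _ ih = begin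
    (((suc (suc q * 2) + (1 + (2 + (suc q + 1)))) + c) + 2 * suc q + 5) * 2
      ≡⟨ lhs c q ⟩
    (c + suc q + 5) * 2 + (8 * suc q + 10)
      ≤⟨ +-monoˡ-≤ (8 * suc q + 10) ih ⟩
    suc n * (4 * suc q + suc n + 5) + (8 * suc q + 10)
      ≤⟨ m≤m+n _ (4 * suc q * n + 2 * n + 4 * q + 2) ⟩
    suc n * (4 * suc q + suc n + 5) + (8 * suc q + 10) + (4 * suc q * n + 2 * n + 4 * q + 2)
      ≡⟨ rhs n q ⟩
    suc (suc n) * (4 * (2 * suc q) + suc (suc n) + 5) ∎
    where
    open ≤-Reasoning

    lhs : ∀ c q → (((suc (suc q * 2) + (1 + (2 + (suc q + 1)))) + c) + 2 * suc q + 5) * 2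
                  ≡ (c + suc q + 5) * 2 + (8 * suc q + 10)
    lhs = solve-∀

    rhs : ∀ n q → suc n * (4 * suc q + suc n + 5) + (8 * suc q + 10) + (4 * suc q * n + 2 * n + 4 * q + 2)
                  ≡ suc (suc n) * (4 * (2 * suc q) + suc (suc n) + 5)
    rhs = solve-∀

cost-within : ∀ n → cost n + 2 ^ suc n + 5 ≤ budget (suc n) / 2
cost-within n = subst (_≤ budget (suc n) / 2) (m*n/n≡m (cost n + 2 ^ suc n + 5) 2)
  (/-monoˡ-≤ 2 (subst (λ p → (cost n + 2 ^ suc n + 5) * 2 ≤ suc n * (p + suc n + 5)) power (cost-bound n)))
  where
  power : 4 * 2 ^ suc n ≡ 2 ^ (suc n + 2)
  power = trans (*-comm 4 (2 ^ suc n)) (sym (^-distribˡ-+-* 2 (suc n) 2))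

theorem2 : ∀ (n : ℕ) → 2 ≤ n →
    (∃ λ h → IsHajósNumber (D (C (2 ^ n + 1))) h
    × h ≤ n * (2 ^ (n + 2) + n + 5) / 2 ∸ 7)
    × (∀ (m : ℕ) → 2 ^ (n ∸ 1) + 1 < 2 * m + 1 → 2 * m + 1 < 2 ^ n + 1 →
    ∃ λ h → IsHajósNumber (D (C (2 * m + 1))) h
    × h ≤ n * (2 ^ (n + 2) + n + 5) / 2 ∸ 5)
theorem2 (suc n) _ = powers , others
  where
  cycle : After (cost n) [] (CycleAvailable (suc (2 ^ n * 2)))
  cycle = mapAfter (λ {Hs} → subst (λ k → CycleAvailable (suc k) Hs) (*-comm 2 (2 ^ n))) (powerCycle n)

  powers : ∃ λ h → IsHajósNumber (D (C (2 ^ suc n + 1))) h × h ≤ budget (suc n) / 2 ∸ 7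
  powers =
    let h , isNumber , h≤ = hajósNumber≤ (2 ^ n) (m^n>0 2 n)
          (trans (cong suc (*-comm (2 ^ n) 2)) (+-comm 1 (2 ^ suc n))) cycle
    in h , isNumber , ≤-trans h≤ (m+n≤o⇒m≤o∸n (cost n) (≤-trans
         (≤-trans (+-monoʳ-≤ (cost n) (+-monoˡ-≤ 5 (*-monoʳ-≤ 2 (m^n>0 2 n))))
                  (≤-reflexive (sym (+-assoc (cost n) (2 ^ suc n) 5))))
         (cost-within n)))

  others : ∀ m → 2 ^ n + 1 < 2 * m + 1 → 2 * m + 1 < 2 ^ suc n + 1 →
           ∃ λ h → IsHajósNumber (D (C (2 * m + 1))) h × h ≤ budget (suc n) / 2 ∸ 5
  others m lower upper =
    let h , isNumber , h≤ = hajósNumber≤ m 0<m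
          (trans (cong suc (*-comm m 2)) (+-comm 1 (2 * m)))
          (bind cycle λ con _ available → shorterCycle 0<m (<⇒≤ m<) con available)
    in h , isNumber , ≤-trans h≤ (m+n≤o⇒m≤o∸n (suc (m * 2) + cost n) (≤-trans
         (+-monoˡ-≤ 5 (≤-trans (≤-reflexive (+-comm (suc (m * 2)) (cost n)))
           (+-monoʳ-≤ (cost n) (subst (_< 2 ^ suc n) (*-comm 2 m) upper′))))
         (cost-within n)))
    where
    upper′ : 2 * m < 2 ^ suc n
    upper′ = +-cancelʳ-< 1 (2 * m) (2 ^ suc n) upper

    m< : m < 2 ^ n
    m< = *-cancelˡ-< 2 m (2 ^ n) upper′

    0<m : 0 < m
    0<m = *-cancelˡ-< 2 0 m (≤-trans (s≤s z≤n) (+-cancelʳ-< 1 (2 ^ n) (2 * m) lower))
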